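{- The central Binomiacci numbers $\mathcal{B}_{n,n}$ satisfy, as $n\to\infty$, $$\mathcal{B}_{n,n} = \frac{3 \cdot 4^n}{\sqrt{\pi n}} + o\left( \frac{4^n}{\sqrt{n}} \right).$$
   Context: $\langle \mathcal{F}_j \rangle_{j\ge 0} = \langle 1,1,2,3,5,8,13,\ldots\rangle$ is the Fibonacci sequence indexed so that $\mathcal{F}_0=\mathcal{F}_1=1$ and $\mathcal{F}_{j+2}=\mathcal{F}_{j+1}+\mathcal{F}_j$. The Binomiacci numbers $\langle \mathcal{B}_{k,n}\rangle_{k,n\ge 0}$ are defined by $\mathcal{B}_{0,n}=\mathcal{F}_n$ for $n\ge 0$, $\mathcal{B}_{k,0}=\mathcal{F}_k$ for $k\ge 0$, and $\mathcal{B}_{k,n}=\mathcal{B}_{k,n-1}+\mathcal{B}_{k-1,n}$ for $k,n\ge 1$. -}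

module Defs where

open import Data.Bool.Base using (if_then_else_)
open import Data.Integer.Base as ℤ using (+_)
import Data.Integer.Properties as ℤ
open import Data.Nat.Base as ℕ using (ℕ; zero; suc; NonZero; z≤n; s≤s)
import Data.Nat.Properties as ℕ
open import Data.Nat.Coprimality using (Coprime)
import Data.Nat.Solver as ℕSolver
open import Data.Product.Base using (∃; _×_; _,_; proj₁; proj₂)
open import Data.Rational.Base as ℚ using (ℚ; 0ℚ; 1ℚ; ½; mkℚ)
import Data.Rational.Properties as ℚ
import Data.Rational.Solver as ℚSolver
import Data.Rational.Unnormalised.Base as ℚᵘ
import Data.Rational.Unnormalised.Properties as ℚᵘ
open import Data.Sum.Base using (_⊎_; inj₁; inj₂)
open import Function.Base using (_∘_; _$_)
open import Relation.Binary.PropositionalEquality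
open import Relation.Nullary using (Dec; does; yes; no; ¬_; contradiction)

-- Indexed so that fib 0 = fib 1 = 1.

fib : ℕ → ℕ
fib 0             = 1
fib 1             = 1
fib (suc (suc j)) = fib (suc j) ℕ.+ fib j

binomiacci : ℕ → ℕ → ℕ
binomiacci zero    n       = fib n
binomiacci (suc k) zero    = fib (suc k)
binomiacci (suc k) (suc n) = binomiacci (suc k) n ℕ.+ binomiacci k (suc n)

∑ : ℕ → (ℕ → ℕ) → ℕ
∑ zero    f = 0
∑ (suc n) f = ∑ n f ℕ.+ f n

[_]₁ : ∀ {P : Set} → Dec P → ℕ
[ P? ]₁ = if does P? then 1 else 0

-- The number of unit squares [i , i+1] × [j , j+1] of the first quadrant
-- contained in the disc of radius N about the origin; a square is
-- contained in the disc exactly when its far corner is.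

squaresInQuarterDisc : ℕ → ℕ
squaresInQuarterDisc N =
  ∑ N λ i → ∑ N λ j →
    [ suc i ℕ.* suc i ℕ.+ suc j ℕ.* suc j ℕ.≤? N ℕ.* N ]₁

-- Refining the grid shows that squaresInQuarterDisc N / N² is Cauchy.

module QuarterDisc where
  open import Data.Nat.Base using (_+_; _*_; _≤_; _<_)
  open import Data.Nat.Properties using (_≤?_)
  open ℕSolver.+-*-Solver

  ∑-mono : ∀ n {f g : ℕ → ℕ} → (∀ i → i < n → f i ≤ g i) → ∑ n f ≤ ∑ n g
  ∑-mono zero    h = z≤n
  ∑-mono (suc n) h = ℕ.+-mono-≤ (∑-mono n λ i i<n → h i (ℕ.m<n⇒m<1+n i<n)) (h n ℕ.≤-refl)

  ∑-const : ∀ n c → ∑ n (λ _ → c) ≡ n * c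
  ∑-const zero    c = refl
  ∑-const (suc n) c = trans (cong (_+ c) (∑-const n c)) (ℕ.+-comm (n * c) c)

  ∑-*ˡ : ∀ n c f → ∑ n (λ i → c * f i) ≡ c * ∑ n f
  ∑-*ˡ zero    c f = sym (ℕ.*-zeroʳ c)
  ∑-*ˡ (suc n) c f = trans (cong (_+ c * f n) (∑-*ˡ n c f)) (sym (ℕ.*-distribˡ-+ c (∑ n f) (f n)))

  ∑-+ : ∀ n f g → ∑ n (λ i → f i + g i) ≡ ∑ n f + ∑ n g
  ∑-+ zero    f g = refl
  ∑-+ (suc n) f g = trans (cong (_+ (f n + g n)) (∑-+ n f g))
    (solve 4 (λ a b c d → a :+ b :+ (c :+ d) := a :+ c :+ (b :+ d)) refl (∑ n f) (∑ n g) (f n) (g n))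

  ∑-head : ∀ n f → ∑ (suc n) f ≡ f 0 + ∑ n (f ∘ suc)
  ∑-head zero    f = ℕ.+-comm 0 (f 0)
  ∑-head (suc n) f = trans (cong (_+ f (suc n)) (∑-head n f)) (ℕ.+-assoc (f 0) _ _)

  ∑-append : ∀ m n f → ∑ (m + n) f ≡ ∑ m f + ∑ n (λ r → f (m + r))
  ∑-append m zero    f = trans (cong (λ k → ∑ k f) (ℕ.+-identityʳ m)) (sym (ℕ.+-identityʳ _))
  ∑-append m (suc n) f = trans (cong (λ k → ∑ k f) (ℕ.+-suc m n))
    (trans (cong (_+ f (m + n)) (∑-append m n f)) (ℕ.+-assoc (∑ m f) _ _))

  ∑-blocks : ∀ n M f → ∑ (n * M) f ≡ ∑ n (λ i → ∑ M λ r → f (i * M + r))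
  ∑-blocks zero    M f = refl
  ∑-blocks (suc n) M f = trans (cong (λ k → ∑ k f) (ℕ.+-comm M (n * M)))
    (trans (∑-append (n * M) M f) (cong (_+ ∑ M (λ r → f (n * M + r))) (∑-blocks n M f)))

  []₁-mono : ∀ {P Q : Set} (P? : Dec P) (Q? : Dec Q) → (P → Q) → [ P? ]₁ ≤ [ Q? ]₁
  []₁-mono (yes p) (yes q) f = ℕ.≤-refl
  []₁-mono (yes p) (no ¬q) f = contradiction (f p) ¬q
  []₁-mono (no ¬p) Q?      f = z≤n

  []₁≤1 : ∀ {P : Set} (P? : Dec P) → [ P? ]₁ ≤ 1
  []₁≤1 (yes _) = ℕ.≤-refl
  []₁≤1 (no  _) = z≤n

  inner outer : ℕ → ℕ → ℕ → ℕ
  inner N i j = [ suc i * suc i + suc j * suc j ≤? N * N ]₁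
  outer N i j = [ i * i + j * j ≤? N * N ]₁

  square : ∀ a b M → (a * M) * (a * M) + (b * M) * (b * M) ≡ (a * a + b * b) * (M * M)
  square = solve 3 (λ a b m → (a :* m) :* (a :* m) :+ (b :* m) :* (b :* m)
                            := (a :* a :+ b :* b) :* (m :* m)) refl

  square₁ : ∀ N M → (N * M) * (N * M) ≡ (N * N) * (M * M)
  square₁ = solve 2 (λ n m → (n :* m) :* (n :* m) := (n :* n) :* (m :* m)) refl

  refine-lower : ∀ N M → M * M * squaresInQuarterDisc N ≤ squaresInQuarterDisc (N * M)
  refine-lower N M = begin
    M * M * ∑ N (λ i → ∑ N (inner N i))
      ≡⟨ sym (∑-*ˡ N (M * M) (λ i → ∑ N (inner N i))) ⟩
    ∑ N (λ i → M * M * ∑ N (inner N i))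
      ≤⟨ ∑-mono N (λ i _ → row i) ⟩
    ∑ N (λ i → ∑ M λ r → ∑ (N * M) (inner (N * M) (i * M + r)))
      ≡⟨ sym (∑-blocks N M (λ I → ∑ (N * M) (inner (N * M) I))) ⟩
    ∑ (N * M) (λ I → ∑ (N * M) (inner (N * M) I)) ∎
    where
    open ℕ.≤-Reasoning
    corner : ∀ i r → r < M → suc (i * M + r) ≤ suc i * M
    corner i r r<M = ℕ.≤-trans (ℕ.≤-reflexive (sym (ℕ.+-suc (i * M) r)))
      (ℕ.≤-trans (ℕ.+-monoʳ-≤ (i * M) r<M) (ℕ.≤-reflexive (ℕ.+-comm (i * M) M)))
    cell : ∀ i j r s → r < M → s < M → inner N i j ≤ inner (N * M) (i * M + r) (j * M + s)
    cell i j r s r<M s<M = []₁-mono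
      (suc i * suc i + suc j * suc j ≤? N * N)
      (suc (i * M + r) * suc (i * M + r) + suc (j * M + s) * suc (j * M + s) ≤? (N * M) * (N * M)) λ h → begin
      suc (i * M + r) * suc (i * M + r) + suc (j * M + s) * suc (j * M + s)
        ≤⟨ ℕ.+-mono-≤ (ℕ.*-mono-≤ (corner i r r<M) (corner i r r<M))
                      (ℕ.*-mono-≤ (corner j s s<M) (corner j s s<M)) ⟩
      (suc i * M) * (suc i * M) + (suc j * M) * (suc j * M)
        ≡⟨ square (suc i) (suc j) M ⟩
      (suc i * suc i + suc j * suc j) * (M * M)
        ≤⟨ ℕ.*-monoˡ-≤ (M * M) h ⟩
      (N * N) * (M * M)
        ≡⟨ sym (square₁ N M) ⟩
      (N * M) * (N * M) ∎
    row : ∀ i → M * M * ∑ N (inner N i) ≤ ∑ M λ r → ∑ (N * M) (inner (N * M) (i * M + r))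
    row i = begin
      M * M * ∑ N (inner N i)                   ≡⟨ ℕ.*-assoc M M _ ⟩
      M * (M * ∑ N (inner N i))                 ≡⟨ sym (∑-const M _) ⟩
      ∑ M (λ r → M * ∑ N (inner N i))           ≤⟨ ∑-mono M (λ r r<M → begin
        M * ∑ N (inner N i)                         ≡⟨ sym (∑-*ˡ N M (inner N i)) ⟩
        ∑ N (λ j → M * inner N i j)                 ≤⟨ ∑-mono N (λ j _ → begin
          M * inner N i j                               ≡⟨ sym (∑-const M _) ⟩
          ∑ M (λ s → inner N i j)                       ≤⟨ ∑-mono M (λ s s<M → cell i j r s r<M s<M) ⟩
          ∑ M (λ s → inner (N * M) (i * M + r) (j * M + s)) ∎) ⟩
        ∑ N (λ j → ∑ M λ s → inner (N * M) (i * M + r) (j * M + s))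
          ≡⟨ sym (∑-blocks N M (inner (N * M) (i * M + r))) ⟩
        ∑ (N * M) (inner (N * M) (i * M + r)) ∎) ⟩
      ∑ M (λ r → ∑ (N * M) (inner (N * M) (i * M + r))) ∎

  refine-outer : ∀ N M .{{_ : NonZero M}} →
    squaresInQuarterDisc (N * M) ≤ M * M * ∑ N (λ i → ∑ N (outer N i))
  refine-outer N M@(suc _) = begin
    ∑ (N * M) (λ I → ∑ (N * M) (inner (N * M) I))
      ≡⟨ ∑-blocks N M (λ I → ∑ (N * M) (inner (N * M) I)) ⟩
    ∑ N (λ i → ∑ M λ r → ∑ (N * M) (inner (N * M) (i * M + r)))
      ≤⟨ ∑-mono N (λ i _ → row i) ⟩
    ∑ N (λ i → M * M * ∑ N (outer N i))
      ≡⟨ ∑-*ˡ N (M * M) (λ i → ∑ N (outer N i)) ⟩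
    M * M * ∑ N (λ i → ∑ N (outer N i)) ∎
    where
    open ℕ.≤-Reasoning
    corner : ∀ i r → i * M ≤ suc (i * M + r)
    corner i r = ℕ.m≤n⇒m≤1+n (ℕ.m≤m+n (i * M) r)
    cell : ∀ i j r s → inner (N * M) (i * M + r) (j * M + s) ≤ outer N i j
    cell i j r s = []₁-mono
      (suc (i * M + r) * suc (i * M + r) + suc (j * M + s) * suc (j * M + s) ≤? (N * M) * (N * M))
      (i * i + j * j ≤? N * N) λ h → ℕ.*-cancelʳ-≤ (i * i + j * j) (N * N) (M * M) (begin
      (i * i + j * j) * (M * M)
        ≡⟨ sym (square i j M) ⟩
      (i * M) * (i * M) + (j * M) * (j * M)
        ≤⟨ ℕ.+-mono-≤ (ℕ.*-mono-≤ (corner i r) (corner i r)) (ℕ.*-mono-≤ (corner j s) (corner j s)) ⟩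
      suc (i * M + r) * suc (i * M + r) + suc (j * M + s) * suc (j * M + s)
        ≤⟨ h ⟩
      (N * M) * (N * M)
        ≡⟨ square₁ N M ⟩
      (N * N) * (M * M) ∎)
    row : ∀ i → ∑ M (λ r → ∑ (N * M) (inner (N * M) (i * M + r))) ≤ M * M * ∑ N (outer N i)
    row i = begin
      ∑ M (λ r → ∑ (N * M) (inner (N * M) (i * M + r))) ≤⟨ ∑-mono M (λ r _ → begin
        ∑ (N * M) (inner (N * M) (i * M + r))
          ≡⟨ ∑-blocks N M (inner (N * M) (i * M + r)) ⟩
        ∑ N (λ j → ∑ M λ s → inner (N * M) (i * M + r) (j * M + s))
          ≤⟨ ∑-mono N (λ j _ → ℕ.≤-trans (∑-mono M λ s _ → cell i j r s) (ℕ.≤-reflexive (∑-const M _))) ⟩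
        ∑ N (λ j → M * outer N i j)
          ≡⟨ ∑-*ˡ N M (outer N i) ⟩
        M * ∑ N (outer N i) ∎) ⟩
      ∑ M (λ r → M * ∑ N (outer N i))           ≡⟨ ∑-const M _ ⟩
      M * (M * ∑ N (outer N i))                 ≡⟨ sym (ℕ.*-assoc M M _) ⟩
      M * M * ∑ N (outer N i)                   ∎

  ∑-shift : ∀ n f → (∀ i → f i ≤ 1) → ∑ n f ≤ 1 + ∑ n (f ∘ suc)
  ∑-shift n f f≤1 = begin
    ∑ n f                   ≤⟨ ℕ.m≤m+n (∑ n f) (f n) ⟩
    ∑ (suc n) f             ≡⟨ ∑-head n f ⟩
    f 0 + ∑ n (f ∘ suc)     ≤⟨ ℕ.+-monoˡ-≤ _ (f≤1 0) ⟩
    1 + ∑ n (f ∘ suc)       ∎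
    where open ℕ.≤-Reasoning

  outer≤ : ∀ N → ∑ N (λ i → ∑ N (outer N i)) ≤ squaresInQuarterDisc N + 2 * N
  outer≤ N = begin
    ∑ N (λ i → ∑ N (outer N i))
      ≤⟨ ℕ.m≤m+n _ _ ⟩
    ∑ (suc N) (λ i → ∑ N (outer N i))
      ≡⟨ ∑-head N (λ i → ∑ N (outer N i)) ⟩
    ∑ N (outer N 0) + ∑ N (λ i → ∑ N (outer N (suc i)))
      ≤⟨ ℕ.+-mono-≤
           (∑-mono N λ j _ → []₁≤1 (0 + j * j ≤? N * N))
           (∑-mono N λ i _ → ∑-shift N (outer N (suc i)) λ j → []₁≤1 (suc i * suc i + j * j ≤? N * N)) ⟩
    ∑ N (λ _ → 1) + ∑ N (λ i → 1 + ∑ N (inner N i))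
      ≡⟨ cong₂ _+_ (∑-const N 1) (∑-+ N (λ _ → 1) (λ i → ∑ N (inner N i))) ⟩
    N * 1 + (∑ N (λ _ → 1) + squaresInQuarterDisc N)
      ≡⟨ cong (λ k → N * 1 + (k + squaresInQuarterDisc N)) (∑-const N 1) ⟩
    N * 1 + (N * 1 + squaresInQuarterDisc N)
      ≡⟨ solve 2 (λ n d → n :* con 1 :+ (n :* con 1 :+ d) := d :+ con 2 :* n) refl N (squaresInQuarterDisc N) ⟩
    squaresInQuarterDisc N + 2 * N ∎
    where open ℕ.≤-Reasoning

  compare : ∀ M N .{{_ : NonZero N}} →
    N * N * squaresInQuarterDisc M ≤ M * M * (squaresInQuarterDisc N + 2 * N)
  compare zero N@(suc _)     = ℕ.≤-reflexive (ℕ.*-zeroʳ (N * N))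
  compare M@(suc _) N@(suc _) = begin
    N * N * squaresInQuarterDisc M                 ≤⟨ refine-lower M N ⟩
    squaresInQuarterDisc (M * N)                   ≡⟨ cong squaresInQuarterDisc (ℕ.*-comm M N) ⟩
    squaresInQuarterDisc (N * M)                   ≤⟨ refine-outer N M ⟩
    M * M * ∑ N (λ i → ∑ N (outer N i))            ≤⟨ ℕ.*-monoʳ-≤ (M * M) (outer≤ N) ⟩
    M * M * (squaresInQuarterDisc N + 2 * N)       ∎
    where open ℕ.≤-Reasoning

-- Opaque only to keep normalisation of fractions out of type checking.

opaque
  frac : (a b : ℕ) .{{_ : NonZero b}} → ℚ
  frac a b = + a ℚ./ b

private
  suc-over-common : ∀ k d → suc k ℕ.* (d ℕ.* d) ≡ (k ℕ.* d ℕ.+ 1 ℕ.* d) ℕ.* d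
  suc-over-common =
    solve 2 (λ k d → (con 1 :+ k) :* (d :* d) := (k :* d :+ con 1 :* d) :* d) refl
    where open ℕSolver.+-*-Solver

module RationalLemmas where
  open import Data.Rational.Base using (_+_; _*_; -_; _-_; _≤_; _<_; ∣_∣; _⊔_; positive; nonNegative)
  open ℚSolver.+-*-Solver

  opaque
    unfolding frac

    toℚᵘ-frac : ∀ a b .{{_ : NonZero b}} → ℚ.toℚᵘ (frac a b) ℚᵘ.≃ (+ a ℚᵘ./ b)
    toℚᵘ-frac a (suc b) = ℚ.toℚᵘ-fromℚᵘ (ℚᵘ.mkℚᵘ (+ a) b)

    frac-0 : ∀ b .{{_ : NonZero b}} → frac 0 b ≡ 0ℚ
    frac-0 b = ℚ.0/n≡0 b

    frac-↥↧ : ∀ a d .(c : Coprime a (suc d)) → frac a (suc d) ≡ mkℚ (+ a) d c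
    frac-↥↧ a d c = ℚ.↥p/↧p≡p (mkℚ (+ a) d c)

  frac-≤ : ∀ a b c d .{{_ : NonZero b}} .{{_ : NonZero d}} →
           a ℕ.* d ℕ.≤ c ℕ.* b → frac a b ≤ frac c d
  frac-≤ a b@(suc b-1) c d@(suc d-1) ad≤cb = ℚ.toℚᵘ-cancel-≤
    (ℚᵘ.≤-respˡ-≃ (ℚᵘ.≃-sym (toℚᵘ-frac a b))
    (ℚᵘ.≤-respʳ-≃ (ℚᵘ.≃-sym (toℚᵘ-frac c d))
    (ℚᵘ.*≤* (subst₂ ℤ._≤_ (ℤ.pos-* a d) (ℤ.pos-* c b) (ℤ.+≤+ ad≤cb)))))

  frac-< : ∀ a b c d .{{_ : NonZero b}} .{{_ : NonZero d}} →
           a ℕ.* d ℕ.< c ℕ.* b → frac a b < frac c d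
  frac-< a b@(suc b-1) c d@(suc d-1) ad<cb = ℚ.toℚᵘ-cancel-<
    (ℚᵘ.<-respˡ-≃ (ℚᵘ.≃-sym (toℚᵘ-frac a b))
    (ℚᵘ.<-respʳ-≃ (ℚᵘ.≃-sym (toℚᵘ-frac c d))
    (ℚᵘ.*<* (subst₂ ℤ._<_ (ℤ.pos-* a d) (ℤ.pos-* c b) (ℤ.+<+ ad<cb)))))

  frac-+ : ∀ a b c d .{{_ : NonZero b}} .{{_ : NonZero d}} .{{_ : NonZero (b ℕ.* d)}} →
           frac a b + frac c d ≡ frac (a ℕ.* d ℕ.+ c ℕ.* b) (b ℕ.* d)
  frac-+ a b@(suc b-1) c d@(suc d-1) = ℚ.toℚᵘ-injective $
    ℚᵘ.≃-trans (ℚ.toℚᵘ-homo-+ (frac a b) (frac c d)) $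
    ℚᵘ.≃-trans (ℚᵘ.+-cong (toℚᵘ-frac a b) (toℚᵘ-frac c d)) $
    ℚᵘ.≃-trans (ℚᵘ.*≡* (cong (ℤ._* + (b ℕ.* d)) eq))
    (ℚᵘ.≃-sym (toℚᵘ-frac (a ℕ.* d ℕ.+ c ℕ.* b) (b ℕ.* d)))
    where
    eq : + a ℤ.* + d ℤ.+ + c ℤ.* + b ≡ + (a ℕ.* d ℕ.+ c ℕ.* b)
    eq = trans (cong₂ ℤ._+_ (sym (ℤ.pos-* a d)) (sym (ℤ.pos-* c b)))
               (sym (ℤ.pos-+ (a ℕ.* d) (c ℕ.* b)))

  frac-* : ∀ a b c d .{{_ : NonZero b}} .{{_ : NonZero d}} .{{_ : NonZero (b ℕ.* d)}} →
           frac a b * frac c d ≡ frac (a ℕ.* c) (b ℕ.* d)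
  frac-* a b@(suc b-1) c d@(suc d-1) = ℚ.toℚᵘ-injective $
    ℚᵘ.≃-trans (ℚ.toℚᵘ-homo-* (frac a b) (frac c d)) $
    ℚᵘ.≃-trans (ℚᵘ.*-cong (toℚᵘ-frac a b) (toℚᵘ-frac c d)) $
    ℚᵘ.≃-trans (ℚᵘ.*≡* (cong (ℤ._* + (b ℕ.* d)) (sym (ℤ.pos-* a c))))
    (ℚᵘ.≃-sym (toℚᵘ-frac (a ℕ.* c) (b ℕ.* d)))

  frac-suc : ∀ k d .{{_ : NonZero d}} → frac (suc k) d ≡ frac k d + frac 1 d
  frac-suc k d@(suc _) = trans
    (ℚ.≤-antisym (frac-≤ (suc k) d n (d ℕ.* d) (ℕ.≤-reflexive eq))
                 (frac-≤ n (d ℕ.* d) (suc k) d (ℕ.≤-reflexive (sym eq))))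
    (sym (frac-+ k d 1 d))
    where
    n  = k ℕ.* d ℕ.+ 1 ℕ.* d
    eq = suc-over-common k d

  0≤frac : ∀ k d .{{_ : NonZero d}} → 0ℚ ≤ frac k d
  0≤frac k d = subst (_≤ frac k d) (frac-0 1) (frac-≤ 0 1 k d z≤n)

  0<frac : ∀ k d .{{_ : NonZero k}} .{{_ : NonZero d}} → 0ℚ < frac k d
  0<frac (suc k) d = subst (_< frac (suc k) d) (frac-0 1) (frac-< 0 1 (suc k) d (s≤s z≤n))

  archimedean : ∀ k ε → 0ℚ < ε →
                ∃ λ N → ∀ M .{{_ : NonZero M}} → N ℕ.≤ M → frac k M ≤ ε
  archimedean k ε@(mkℚ (+ 0)        d-1 _) 0<ε with () ← positive 0<ε
  archimedean k ε@(mkℚ (ℤ.-[1+ _ ]) d-1 _) 0<ε with () ← positive 0<ε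
  archimedean k ε@(mkℚ (+ suc n)    d-1 c) 0<ε = k ℕ.* suc d-1 , λ M kd≤M →
    subst (frac k M ≤_) (frac-↥↧ (suc n) d-1 c)
      (frac-≤ k M (suc n) (suc d-1) (ℕ.≤-trans kd≤M (ℕ.m≤m+n M (n ℕ.* M))))

  *-pos : ∀ {p q} → 0ℚ < p → 0ℚ < q → 0ℚ < p * q
  *-pos {p} {q} 0<p 0<q = ℚ.positive⁻¹ (p * q) {{ℚ.pos*pos⇒pos p {{positive 0<p}} q {{positive 0<q}}}}

  half : ∀ {ε} → 0ℚ < ε → 0ℚ < ½ * ε
  half = *-pos (ℚ.positive⁻¹ ½)

  ½+½ : ∀ ε → ½ * ε + ½ * ε ≡ ε
  ½+½ = solve 1 (λ e → con ½ :* e :+ con ½ :* e := e) refl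

  +-nonNeg : ∀ {p q} → 0ℚ ≤ p → 0ℚ ≤ q → 0ℚ ≤ p + q
  +-nonNeg = ℚ.+-mono-≤

  p≤p+q : ∀ p {q} → 0ℚ ≤ q → p ≤ p + q
  p≤p+q p 0≤q = subst (_≤ p + _) (ℚ.+-identityʳ p) (ℚ.+-monoʳ-≤ p 0≤q)

  *-mono : ∀ {p q r s} → 0ℚ ≤ p → 0ℚ ≤ s → p ≤ q → r ≤ s → p * r ≤ q * s
  *-mono {p} {q} {r} {s} 0≤p 0≤s p≤q r≤s = ℚ.≤-trans
    (ℚ.*-monoˡ-≤-nonNeg p {{nonNegative 0≤p}} r≤s)
    (ℚ.*-monoʳ-≤-nonNeg s {{nonNegative 0≤s}} p≤q)

  p≤∣p∣ : ∀ p → p ≤ ∣ p ∣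
  p≤∣p∣ p with ℚ.≤-total 0ℚ p
  ... | inj₁ 0≤p = ℚ.≤-reflexive (sym (ℚ.0≤p⇒∣p∣≡p 0≤p))
  ... | inj₂ p≤0 = ℚ.≤-trans p≤0 (ℚ.0≤∣p∣ p)

  -‿swap : ∀ p q → - (p - q) ≡ q - p
  -‿swap = solve 2 (λ p q → :- (p :- q) := q :- p) refl

  ≤+⇒-≤ : ∀ p q {e} → p ≤ q + e → p - q ≤ e
  ≤+⇒-≤ p q {e} h = subst (p - q ≤_)
    (solve 2 (λ q e → q :+ e :- q := e) refl q e) (ℚ.+-monoˡ-≤ (- q) h)

  -≤⇒≤+ : ∀ p q {e} → p - q ≤ e → p ≤ q + e
  -≤⇒≤+ p q {e} h = subst (_≤ q + e)
    (solve 2 (λ p q → q :+ (p :- q) := p) refl p q) (ℚ.+-monoʳ-≤ q h)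

  dist⇒≤ : ∀ p q {e} → ∣ p - q ∣ ≤ e → p ≤ q + e
  dist⇒≤ p q h = -≤⇒≤+ p q (ℚ.≤-trans (p≤∣p∣ (p - q)) h)

  ≤⇒dist : ∀ p q {e} → p ≤ q + e → q ≤ p + e → ∣ p - q ∣ ≤ e
  ≤⇒dist p q {e} h k with ℚ.∣p∣≡p∨∣p∣≡-p (p - q)
  ... | inj₁ eq = subst (_≤ e) (sym eq) (≤+⇒-≤ p q h)
  ... | inj₂ eq = subst (_≤ e) (sym (trans eq (-‿swap p q))) (≤+⇒-≤ q p k)

  ∣∣-≤ : ∀ p q {e} → ∣ p - q ∣ ≤ e → ∣ p ∣ ≤ ∣ q ∣ + e
  ∣∣-≤ p q {e} h = ℚ.≤-trans
    (subst (λ r → ∣ r ∣ ≤ ∣ q ∣ + ∣ p - q ∣)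
      (solve 2 (λ p q → q :+ (p :- q) := p) refl p q)
      (ℚ.∣p+q∣≤∣p∣+∣q∣ q (p - q)))
    (ℚ.+-monoʳ-≤ ∣ q ∣ h)

  ⊔-≤ : ∀ p q r {e} → 0ℚ ≤ e → p ≤ q + e → p ⊔ r ≤ (q ⊔ r) + e
  ⊔-≤ p q r {e} 0≤e h = ℚ.⊔-lub
    (ℚ.≤-trans h (ℚ.+-monoˡ-≤ e (ℚ.p≤p⊔q q r)))
    (ℚ.≤-trans (ℚ.p≤q⊔p q r) (p≤p+q (q ⊔ r) 0≤e))

  -- Any tolerance ε admits δ with K δ ≤ ε.
  shrink : ∀ K ε → 0ℚ < K → 0ℚ < ε → ∃ λ δ → 0ℚ < δ × K * δ ≡ ε
  shrink K ε 0<K 0<ε = ε * 1/K , *-pos 0<ε (ℚ.positive⁻¹ 1/K {{ℚ.1/pos⇒pos K}}) , (begin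
    K * (ε * 1/K)  ≡⟨ solve 3 (λ k e i → k :* (e :* i) := (k :* i) :* e) refl K ε 1/K ⟩
    (K * 1/K) * ε  ≡⟨ cong (_* ε) (ℚ.*-inverseʳ K) ⟩
    1ℚ * ε         ≡⟨ ℚ.*-identityˡ ε ⟩
    ε              ∎)
    where
    open ≡-Reasoning
    instance
      pos = positive 0<K
      nz  = ℚ.pos⇒nonZero K
    1/K = ℚ.1/ K

open RationalLemmas

Eventually : (ℕ → Set) → Set
Eventually P = ∃ λ N → ∀ n → N ℕ.≤ n → P n

Cauchy : (ℕ → ℚ) → Set
Cauchy x = ∀ ε → 0ℚ ℚ.< ε →
  ∃ λ N → ∀ m n → N ℕ.≤ m → N ℕ.≤ n → ℚ.∣ x m ℚ.- x n ∣ ℚ.≤ ε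

-- A real number is a Cauchy sequence of rationals with a modulus of
-- convergence.  Different sequences may represent the same number, so reals
-- are compared only through _≤_ and _<_, which respect this.

record ℝ : Set where
  no-eta-equality
  field
    seq    : ℕ → ℚ
    cauchy : Cauchy seq
open ℝ public

infix 4 _≤_ _<_

_≤_ : ℝ → ℝ → Set
x ≤ y = ∀ ε → 0ℚ ℚ.< ε → Eventually λ n → seq x n ℚ.≤ seq y n ℚ.+ ε

record _<_ (x y : ℝ) : Set where
  no-eta-equality; pattern
  constructor mk<
  field
    gap   : ℚ
    0<gap : 0ℚ ℚ.< gap
    below : Eventually λ n → seq x n ℚ.+ gap ℚ.≤ seq y n

-- The bound is symmetric in m and n, so a one-sided estimate suffices.

one-sided⇒Cauchy : ∀ x →
  (∀ ε → 0ℚ ℚ.< ε → ∃ λ N → ∀ m n → N ℕ.≤ m → N ℕ.≤ n → x m ℚ.≤ x n ℚ.+ ε) →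
  Cauchy x
one-sided⇒Cauchy x h ε 0<ε with N , p ← h ε 0<ε =
  N , λ m n N≤m N≤n → ≤⇒dist (x m) (x n) (p m n N≤m N≤n) (p n m N≤n N≤m)

eventually-bounded : ∀ x → Cauchy x →
  ∃ λ K → 0ℚ ℚ.< K × Eventually λ n → ℚ.∣ x n ∣ ℚ.≤ K
eventually-bounded x c with N , p ← c 1ℚ (ℚ.positive⁻¹ 1ℚ) =
  ℚ.∣ x N ∣ ℚ.+ 1ℚ ,
  ℚ.+-mono-≤-< (ℚ.0≤∣p∣ (x N)) (ℚ.positive⁻¹ 1ℚ) ,
  N , λ n N≤n → ∣∣-≤ (x n) (x N) (p n N N≤n ℕ.≤-refl)

infix  8 -_
infixl 7 _*_ _/_
infixl 6 _+_ _-_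

fromℚ : ℚ → ℝ
seq    (fromℚ q) _ = q
cauchy (fromℚ q) ε 0<ε = 0 , λ _ _ _ _ →
  ≤⇒dist q q (p≤p+q q (ℚ.<⇒≤ 0<ε)) (p≤p+q q (ℚ.<⇒≤ 0<ε))

fromℕ : ℕ → ℝ
fromℕ n = fromℚ (frac n 1)

0ℝ : ℝ
0ℝ = fromℚ 0ℚ

private
  merge : ∀ {P Q : ℕ → ℕ → Set} →
    (∃ λ N → ∀ m n → N ℕ.≤ m → N ℕ.≤ n → P m n) →
    (∃ λ N → ∀ m n → N ℕ.≤ m → N ℕ.≤ n → Q m n) →
    ∃ λ N → ∀ m n → N ℕ.≤ m → N ℕ.≤ n → P m n × Q m n
  merge (M , p) (N , q) = M ℕ.⊔ N , λ m n m≥ n≥ →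
    p m n (ℕ.m⊔n≤o⇒m≤o M N m≥) (ℕ.m⊔n≤o⇒m≤o M N n≥) ,
    q m n (ℕ.m⊔n≤o⇒n≤o M N m≥) (ℕ.m⊔n≤o⇒n≤o M N n≥)

  both : ∀ {P : ℕ → Set} → Eventually P →
    ∃ λ N → ∀ m n → N ℕ.≤ m → N ℕ.≤ n → P m × P n
  both (N , p) = N , λ m n N≤m N≤n → p m N≤m , p n N≤n

Eventually-× : ∀ {P Q : ℕ → Set} →
  Eventually P → Eventually Q → Eventually λ n → P n × Q n
Eventually-× (M , p) (N , q) = M ℕ.⊔ N , λ n n≥ →
  p n (ℕ.m⊔n≤o⇒m≤o M N n≥) , q n (ℕ.m⊔n≤o⇒n≤o M N n≥)

_+_ : ℝ → ℝ → ℝ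
seq    (x + y) n = seq x n ℚ.+ seq y n
cauchy (x + y) = one-sided⇒Cauchy (λ n → seq x n ℚ.+ seq y n) λ ε 0<ε →
  let N , p = merge (cauchy x (½ ℚ.* ε) (half 0<ε)) (cauchy y (½ ℚ.* ε) (half 0<ε))
  in N , λ m n N≤m N≤n → let px , py = p m n N≤m N≤n in
  subst (_ ℚ.≤_)
    (trans (solve 3 (λ a b h → a :+ h :+ (b :+ h) := a :+ b :+ (h :+ h)) refl (seq x n) (seq y n) (½ ℚ.* ε))
           (cong (seq x n ℚ.+ seq y n ℚ.+_) (½+½ ε)))
    (ℚ.+-mono-≤ (dist⇒≤ (seq x m) (seq x n) px) (dist⇒≤ (seq y m) (seq y n) py))
  where open ℚSolver.+-*-Solver

-_ : ℝ → ℝ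
seq    (- x) n = ℚ.- seq x n
cauchy (- x) ε 0<ε =
  let N , p = cauchy x ε 0<ε
  in N , λ m n N≤m N≤n → subst (ℚ._≤ ε)
       (cong ℚ.∣_∣ (solve 2 (λ a b → b :- a := :- a :- :- b) refl (seq x m) (seq x n)))
       (p n m N≤n N≤m)
  where open ℚSolver.+-*-Solver

_-_ : ℝ → ℝ → ℝ
x - y = x + - y

_*_ : ℝ → ℝ → ℝ
seq    (x * y) n = seq x n ℚ.* seq y n
cauchy (x * y) ε 0<ε =
  let K , 0<K , bx     = eventually-bounded (seq x) (cauchy x)
      L , 0<L , by     = eventually-bounded (seq y) (cauchy y)
      δ , 0<δ , Kδ≡½ε  = shrink K (½ ℚ.* ε) 0<K (half 0<ε)
      η , 0<η , Lη≡½ε  = shrink L (½ ℚ.* ε) 0<L (half 0<ε)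
      N , p = merge (merge (both bx) (both by)) (merge (cauchy x η 0<η) (cauchy y δ 0<δ))
  in N , λ m n N≤m N≤n →
  let ((∣xm∣≤K , _) , (_ , ∣yn∣≤L)) , (dx , dy) = p m n N≤m N≤n
      a = seq x m ; b = seq x n ; c = seq y m ; d = seq y n
  in begin
    ℚ.∣ a ℚ.* c ℚ.- b ℚ.* d ∣
      ≡⟨ cong ℚ.∣_∣ (solve 4 (λ a b c d → a :* c :- b :* d := a :* (c :- d) :+ d :* (a :- b)) refl a b c d) ⟩
    ℚ.∣ a ℚ.* (c ℚ.- d) ℚ.+ d ℚ.* (a ℚ.- b) ∣
      ≤⟨ ℚ.∣p+q∣≤∣p∣+∣q∣ (a ℚ.* (c ℚ.- d)) (d ℚ.* (a ℚ.- b)) ⟩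
    ℚ.∣ a ℚ.* (c ℚ.- d) ∣ ℚ.+ ℚ.∣ d ℚ.* (a ℚ.- b) ∣
      ≡⟨ cong₂ ℚ._+_ (ℚ.∣p*q∣≡∣p∣*∣q∣ a (c ℚ.- d)) (ℚ.∣p*q∣≡∣p∣*∣q∣ d (a ℚ.- b)) ⟩
    ℚ.∣ a ∣ ℚ.* ℚ.∣ c ℚ.- d ∣ ℚ.+ ℚ.∣ d ∣ ℚ.* ℚ.∣ a ℚ.- b ∣
      ≤⟨ ℚ.+-mono-≤ (*-mono (ℚ.0≤∣p∣ a) (ℚ.<⇒≤ 0<δ) ∣xm∣≤K dy)
                    (*-mono (ℚ.0≤∣p∣ d) (ℚ.<⇒≤ 0<η) ∣yn∣≤L dx) ⟩
    K ℚ.* δ ℚ.+ L ℚ.* η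
      ≡⟨ cong₂ ℚ._+_ Kδ≡½ε Lη≡½ε ⟩
    ½ ℚ.* ε ℚ.+ ½ ℚ.* ε
      ≡⟨ ½+½ ε ⟩
    ε ∎
  where
  open ℚSolver.+-*-Solver
  open ℚ.≤-Reasoning

∣_∣ : ℝ → ℝ
seq    ∣ x ∣ n = ℚ.∣ seq x n ∣
cauchy ∣ x ∣ = one-sided⇒Cauchy (λ n → ℚ.∣ seq x n ∣) λ ε 0<ε →
  let N , p = cauchy x ε 0<ε in N , λ m n N≤m N≤n → ∣∣-≤ (seq x m) (seq x n) (p m n N≤m N≤n)

-- Once δ > 0 bounds y from below, max(yₙ , δ) agrees with yₙ for large n
-- and is everywhere safe to invert.

module Reciprocal (y : ℝ) (0<y : 0ℝ < y) where
  open _<_ 0<y renaming (gap to δ; 0<gap to 0<δ)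

  cut : ℕ → ℚ
  cut n = seq y n ℚ.⊔ δ

  0<cut : ∀ n → 0ℚ ℚ.< cut n
  0<cut n = ℚ.<-≤-trans 0<δ (ℚ.p≤q⊔p (seq y n) δ)

  1/cut : ℕ → ℚ
  1/cut n = (ℚ.1/ cut n) {{ℚ.>-nonZero (0<cut n)}}

  cut*1/cut : ∀ n → cut n ℚ.* 1/cut n ≡ 1ℚ
  cut*1/cut n = ℚ.*-inverseʳ (cut n) {{ℚ.>-nonZero (0<cut n)}}

  0<1/cut : ∀ n → 0ℚ ℚ.< 1/cut n
  0<1/cut n = ℚ.positive⁻¹ (1/cut n) {{ℚ.1/pos⇒pos (cut n) {{ℚ.positive (0<cut n)}}}}

  1/cut-cauchy : Cauchy 1/cut
  1/cut-cauchy = one-sided⇒Cauchy 1/cut λ ε 0<ε →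
    let N , p = cauchy y (δ ℚ.* δ ℚ.* ε) (*-pos (*-pos 0<δ 0<δ) 0<ε)
    in N , λ m n N≤m N≤n →
    let u = cut m ; v = cut n ; i = 1/cut m ; j = 1/cut n
        instance
          _ = ℚ.positive (*-pos (0<cut m) (0<cut n))
        step : v ℚ.≤ u ℚ.+ u ℚ.* v ℚ.* ε
        step = begin
          v                        ≤⟨ ⊔-≤ (seq y n) (seq y m) δ (ℚ.<⇒≤ (*-pos (*-pos 0<δ 0<δ) 0<ε))
                                        (dist⇒≤ (seq y n) (seq y m) (p n m N≤n N≤m)) ⟩
          u ℚ.+ δ ℚ.* δ ℚ.* ε      ≤⟨ ℚ.+-monoʳ-≤ u (ℚ.*-monoʳ-≤-nonNeg ε {{ℚ.nonNegative (ℚ.<⇒≤ 0<ε)}}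
                                        (*-mono (ℚ.<⇒≤ 0<δ) (ℚ.<⇒≤ (0<cut n))
                                          (ℚ.p≤q⊔p (seq y m) δ) (ℚ.p≤q⊔p (seq y n) δ))) ⟩
          u ℚ.+ u ℚ.* v ℚ.* ε      ∎
    in ℚ.*-cancelˡ-≤-pos (u ℚ.* v) (begin
      u ℚ.* v ℚ.* i                 ≡⟨ solve 3 (λ u v i → u :* v :* i := v :* (u :* i)) refl u v i ⟩
      v ℚ.* (u ℚ.* i)               ≡⟨ cong (v ℚ.*_) (cut*1/cut m) ⟩
      v ℚ.* 1ℚ                      ≡⟨ ℚ.*-identityʳ v ⟩
      v                             ≤⟨ step ⟩
      u ℚ.+ u ℚ.* v ℚ.* ε           ≡⟨ cong (ℚ._+ u ℚ.* v ℚ.* ε) (sym (ℚ.*-identityʳ u)) ⟩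
      u ℚ.* 1ℚ ℚ.+ u ℚ.* v ℚ.* ε    ≡⟨ cong (λ w → u ℚ.* w ℚ.+ u ℚ.* v ℚ.* ε) (sym (cut*1/cut n)) ⟩
      u ℚ.* (v ℚ.* j) ℚ.+ u ℚ.* v ℚ.* ε
        ≡⟨ solve 4 (λ u v j e → u :* (v :* j) :+ u :* v :* e := u :* v :* (j :+ e)) refl u v j ε ⟩
      u ℚ.* v ℚ.* (j ℚ.+ ε)         ∎)
    where
    open ℚSolver.+-*-Solver
    open ℚ.≤-Reasoning

recip : (y : ℝ) {{0<y : 0ℝ < y}} → ℝ
seq    (recip y {{0<y}}) = Reciprocal.1/cut y 0<y
cauchy (recip y {{0<y}}) = Reciprocal.1/cut-cauchy y 0<y

_/_ : (x y : ℝ) {{0<y : 0ℝ < y}} → ℝ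
x / y = x * recip y

if-elim : ∀ {P : Set} (C : ℕ → Set) {a b : ℕ} (P? : Dec P) →
          (P → C a) → (¬ P → C b) → C (if does P? then a else b)
if-elim C (yes p) f g = f p
if-elim C (no ¬p) f g = g ¬p

-- The largest k ≤ b with (k / d)² ≤ q (or 0 if there is none).

rootSearch : (q : ℚ) (d : ℕ) .{{_ : NonZero d}} → ℕ → ℕ
rootSearch q d zero    = 0
rootSearch q d (suc k) =
  if does (frac (suc k) d ℚ.* frac (suc k) d ℚ.≤? q) then suc k else rootSearch q d k

-- √ max(q , 0) rounded down to a multiple of 1 / d; the search bound is
-- large enough because q ≤ ∣ ↥ q ∣ ≤ ∣ ↥ q ∣².

rootApprox : (q : ℚ) (d : ℕ) .{{_ : NonZero d}} → ℚ
rootApprox q d = frac (rootSearch q d (ℤ.∣ ℚ.↥ q ∣ ℕ.* d)) d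

0≤rootApprox : ∀ q d .{{_ : NonZero d}} → 0ℚ ℚ.≤ rootApprox q d
0≤rootApprox q d = 0≤frac (rootSearch q d (ℤ.∣ ℚ.↥ q ∣ ℕ.* d)) d

rootApprox² : ∀ q d .{{_ : NonZero d}} → 0ℚ ℚ.≤ q →
              rootApprox q d ℚ.* rootApprox q d ℚ.≤ q
rootApprox² q d 0≤q = go (ℤ.∣ ℚ.↥ q ∣ ℕ.* d)
  where
  go : ∀ b → frac (rootSearch q d b) d ℚ.* frac (rootSearch q d b) d ℚ.≤ q
  go zero = subst (ℚ._≤ q) (sym (trans (cong (λ z → z ℚ.* z) (frac-0 d)) (ℚ.*-zeroˡ 0ℚ))) 0≤q
  go (suc b) = if-elim (λ k → frac k d ℚ.* frac k d ℚ.≤ q)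
    (frac (suc b) d ℚ.* frac (suc b) d ℚ.≤? q) (λ p → p) (λ _ → go b)

q<rootApprox² : ∀ q d .{{_ : NonZero d}} → 0ℚ ℚ.≤ q →
  q ℚ.< (rootApprox q d ℚ.+ frac 1 d) ℚ.* (rootApprox q d ℚ.+ frac 1 d)
q<rootApprox² q d 0≤q =
  subst (λ z → q ℚ.< z ℚ.* z) (frac-suc (rootSearch q d top) d) (go top (start q d 0≤q))
  where
  top = ℤ.∣ ℚ.↥ q ∣ ℕ.* d

  go : ∀ b → q ℚ.< frac (suc b) d ℚ.* frac (suc b) d →
       q ℚ.< frac (suc (rootSearch q d b)) d ℚ.* frac (suc (rootSearch q d b)) d
  go zero    h = h
  go (suc b) h = if-elim (λ k → q ℚ.< frac (suc k) d ℚ.* frac (suc k) d)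
    (frac (suc b) d ℚ.* frac (suc b) d ℚ.≤? q) (λ _ → h) (λ ¬p → go b (ℚ.≰⇒> ¬p))

  start : ∀ q d .{{_ : NonZero d}} → 0ℚ ℚ.≤ q → let t = suc (ℤ.∣ ℚ.↥ q ∣ ℕ.* d) in
          q ℚ.< frac t d ℚ.* frac t d
  start q@(mkℚ ℤ.-[1+ _ ] _ _) d 0≤q with () ← ℚ.nonNegative 0≤q
  start q@(mkℚ (+ a) c-1 c) d@(suc _) _ = subst₂ ℚ._<_ (frac-↥↧ a c-1 c) (sym (frac-* t d t d))
    (frac-< a (suc c-1) (t ℕ.* t) (d ℕ.* d)
      (ℕ.<-≤-trans (s≤s (ℕ.≤-trans (a≤a² a) (ℕ.m≤m+n _ _)))
        (ℕ.≤-trans (ℕ.≤-reflexive square) (ℕ.m≤m*n (t ℕ.* t) (suc c-1)))))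
    where
    t = suc (a ℕ.* d)
    a≤a² : ∀ a → a ℕ.* (d ℕ.* d) ℕ.≤ a ℕ.* a ℕ.* (d ℕ.* d)
    a≤a² zero    = z≤n
    a≤a² (suc a) = ℕ.*-monoˡ-≤ (d ℕ.* d) (ℕ.m≤m*n (suc a) (suc a))
    square : suc (a ℕ.* a ℕ.* (d ℕ.* d) ℕ.+ (a ℕ.* d ℕ.+ a ℕ.* d)) ≡ t ℕ.* t
    square = solve 2 (λ a d → con 1 :+ (a :* a :* (d :* d) :+ (a :* d :+ a :* d))
                            := (con 1 :+ a :* d) :* (con 1 :+ a :* d)) refl a d
      where open ℕSolver.+-*-Solver

-- √ x means √ max(x , 0).

√-seq : ℝ → ℕ → ℚ
√-seq x n = rootApprox (seq x n ℚ.⊔ 0ℚ) (suc n)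

-- q ≤ p + η², r² ≤ q and p < t² force r ≤ t + η.
root-compare : ∀ {p q r t η} → 0ℚ ℚ.≤ t → 0ℚ ℚ.≤ η → q ℚ.≤ p ℚ.+ η ℚ.* η →
  r ℚ.* r ℚ.≤ q → p ℚ.< t ℚ.* t → r ℚ.≤ t ℚ.+ η
root-compare {p} {q} {r} {t} {η} 0≤t 0≤η q≤ r²≤q p<t² with r ℚ.≤? t ℚ.+ η
... | yes h = h
... | no ¬h = contradiction refl (ℚ.<⇒≢ (begin-strict
  (t ℚ.+ η) ℚ.* (t ℚ.+ η)                            ≤⟨ *-mono (+-nonNeg 0≤t 0≤η) 0≤r t+η≤r t+η≤r ⟩
  r ℚ.* r                                            ≤⟨ r²≤q ⟩
  q                                                  ≤⟨ q≤ ⟩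
  p ℚ.+ η ℚ.* η                                      <⟨ ℚ.+-monoˡ-< (η ℚ.* η) p<t² ⟩
  t ℚ.* t ℚ.+ η ℚ.* η                                ≤⟨ p≤p+q _ (+-nonNeg 0≤tη 0≤tη) ⟩
  t ℚ.* t ℚ.+ η ℚ.* η ℚ.+ (t ℚ.* η ℚ.+ t ℚ.* η)
    ≡⟨ solve 2 (λ t e → t :* t :+ e :* e :+ (t :* e :+ t :* e) := (t :+ e) :* (t :+ e)) refl t η ⟩
  (t ℚ.+ η) ℚ.* (t ℚ.+ η)                            ∎))
  where
  open ℚSolver.+-*-Solver
  open ℚ.≤-Reasoning
  t+η≤r : t ℚ.+ η ℚ.≤ r
  t+η≤r = ℚ.<⇒≤ (ℚ.≰⇒> ¬h)
  0≤r : 0ℚ ℚ.≤ r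
  0≤r = ℚ.≤-trans (+-nonNeg 0≤t 0≤η) t+η≤r
  0≤tη : 0ℚ ℚ.≤ t ℚ.* η
  0≤tη = ℚ.nonNegative⁻¹ _ {{ℚ.nonNeg*nonNeg⇒nonNeg t {{ℚ.nonNegative 0≤t}} η {{ℚ.nonNegative 0≤η}}}}

√-cauchy : ∀ x → Cauchy (√-seq x)
√-cauchy x = one-sided⇒Cauchy (√-seq x) λ ε 0<ε →
  let η      = ½ ℚ.* ε
      0<η    = half 0<ε
      A , fr = archimedean 1 η 0<η
      N , p  = merge (cauchy x (η ℚ.* η) (*-pos 0<η 0<η)) (both (A , λ n A≤n → fr (suc n) (ℕ.m≤n⇒m≤1+n A≤n)))
  in N , λ m n N≤m N≤n →
  let dx , (_ , 1/n≤η) = p m n N≤m N≤n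
      0≤[_] = λ k → ℚ.p≤q⊔p (seq x k) 0ℚ
      r = √-seq x m ; s = √-seq x n ; 1/n = frac 1 (suc n)
      open ℚSolver.+-*-Solver
      open ℚ.≤-Reasoning
  in begin
    r                      ≤⟨ root-compare {r = r}
                                (+-nonNeg (0≤rootApprox (seq x n ℚ.⊔ 0ℚ) (suc n)) (0≤frac 1 (suc n))) (ℚ.<⇒≤ 0<η)
                                (⊔-≤ (seq x m) (seq x n) 0ℚ (ℚ.<⇒≤ (*-pos 0<η 0<η)) (dist⇒≤ (seq x m) (seq x n) dx))
                                (rootApprox² (seq x m ℚ.⊔ 0ℚ) (suc m) 0≤[ m ])
                                (q<rootApprox² (seq x n ℚ.⊔ 0ℚ) (suc n) 0≤[ n ]) ⟩
    s ℚ.+ 1/n ℚ.+ η        ≤⟨ ℚ.+-monoˡ-≤ η (ℚ.+-monoʳ-≤ s 1/n≤η) ⟩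
    s ℚ.+ η ℚ.+ η          ≡⟨ ℚ.+-assoc s η η ⟩
    s ℚ.+ (η ℚ.+ η)        ≡⟨ cong (s ℚ.+_) (½+½ ε) ⟩
    s ℚ.+ ε                ∎

√ : ℝ → ℝ
seq    (√ x) = √-seq x
cauchy (√ x) = √-cauchy x

-- π is the area of the unit disc: π-seq n is the total area of the squares,
-- over all four quadrants, of the grid of mesh 1 / (n + 1) that are contained in
-- the disc.

π-seq : ℕ → ℚ
π-seq n = frac (4 ℕ.* squaresInQuarterDisc (suc n)) (suc n ℕ.* suc n)

π-seq-≤ : ∀ m n → π-seq m ℚ.≤ π-seq n ℚ.+ frac 8 (suc n)
π-seq-≤ m n = subst (π-seq m ℚ.≤_) (sym (frac-+ (4 ℕ.* b) (N ℕ.* N) 8 N))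
  (frac-≤ (4 ℕ.* a) (M ℕ.* M) (4 ℕ.* b ℕ.* N ℕ.+ 8 ℕ.* (N ℕ.* N)) (N ℕ.* N ℕ.* N) (begin
    4 ℕ.* a ℕ.* (N ℕ.* N ℕ.* N)
      ≡⟨ solve 2 (λ a n → con 4 :* a :* (n :* n :* n) := con 4 :* n :* (n :* n :* a)) refl a N ⟩
    4 ℕ.* N ℕ.* (N ℕ.* N ℕ.* a)
      ≤⟨ ℕ.*-monoʳ-≤ (4 ℕ.* N) (QuarterDisc.compare M N) ⟩
    4 ℕ.* N ℕ.* (M ℕ.* M ℕ.* (b ℕ.+ 2 ℕ.* N))
      ≡⟨ solve 3 (λ m n b → con 4 :* n :* (m :* m :* (b :+ con 2 :* n))
                          := (con 4 :* b :* n :+ con 8 :* (n :* n)) :* (m :* m)) refl M N b ⟩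
    (4 ℕ.* b ℕ.* N ℕ.+ 8 ℕ.* (N ℕ.* N)) ℕ.* (M ℕ.* M) ∎))
  where
  M = suc m
  N = suc n
  a = squaresInQuarterDisc M
  b = squaresInQuarterDisc N
  open ℕSolver.+-*-Solver
  open ℕ.≤-Reasoning

π : ℝ
seq    π = π-seq
cauchy π = one-sided⇒Cauchy π-seq λ ε 0<ε →
  let N , p = archimedean 8 ε 0<ε
  in N , λ m n _ N≤n → ℚ.≤-trans (π-seq-≤ m n)
       (ℚ.+-monoʳ-≤ (π-seq n) (p (suc n) (ℕ.m≤n⇒m≤1+n N≤n)))

instance
  fromℕ-pos : ∀ {n} .{{_ : NonZero n}} → 0ℝ < fromℕ n
  fromℕ-pos {n} = mk< (frac n 1) (0<frac n 1) (0 , λ _ _ → ℚ.≤-reflexive (ℚ.+-identityˡ _))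

  *-pos-ℝ : ∀ {x y} {{_ : 0ℝ < x}} {{_ : 0ℝ < y}} → 0ℝ < x * y
  *-pos-ℝ {x} {y} {{mk< δ 0<δ (M , p)}} {{mk< η 0<η (N , q)}} =
    mk< (δ ℚ.* η) (*-pos 0<δ 0<η) $ M ℕ.⊔ N , λ n n≥ →
      let δ≤x = subst (ℚ._≤ seq x n) (ℚ.+-identityˡ δ) (p n (ℕ.m⊔n≤o⇒m≤o M N n≥))
          η≤y = subst (ℚ._≤ seq y n) (ℚ.+-identityˡ η) (q n (ℕ.m⊔n≤o⇒n≤o M N n≥))
      in subst (ℚ._≤ seq x n ℚ.* seq y n) (sym (ℚ.+-identityˡ (δ ℚ.* η)))
           (*-mono (ℚ.<⇒≤ 0<δ) (ℚ.≤-trans (ℚ.<⇒≤ 0<η) η≤y) δ≤x η≤y)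

  √-pos : ∀ {x} {{_ : 0ℝ < x}} → 0ℝ < √ x
  √-pos {x} {{mk< δ 0<δ (M , p)}} =
    mk< (½ ℚ.* η) (half 0<η) $ M ℕ.⊔ A , λ n n≥ →
      let q   = seq x n ℚ.⊔ 0ℚ
          δ≤q = ℚ.≤-trans (subst (ℚ._≤ seq x n) (ℚ.+-identityˡ δ) (p n (ℕ.m⊔n≤o⇒m≤o M A n≥)))
                          (ℚ.p≤p⊔q (seq x n) 0ℚ)
          r   = √-seq x n
          1/n = frac 1 (suc n)
          0≤t = +-nonNeg (0≤rootApprox q (suc n)) (0≤frac 1 (suc n))
          η≤t : η ℚ.≤ r ℚ.+ 1/n
          η≤t = subst (η ℚ.≤_) (ℚ.+-identityʳ _)
                  (root-compare {p = q} {q = q} {r = η} {η = 0ℚ} 0≤t ℚ.≤-refl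
                    (ℚ.≤-reflexive (sym (ℚ.+-identityʳ q)))
                    (ℚ.≤-trans η²≤δ δ≤q)
                    (q<rootApprox² q (suc n) (ℚ.p≤q⊔p (seq x n) 0ℚ)))
          1/n≤½η = fr (suc n) (ℕ.m≤n⇒m≤1+n (ℕ.m⊔n≤o⇒n≤o M A n≥))
      in begin
        0ℚ ℚ.+ ½ ℚ.* η                        ≡⟨ solve 1 (λ e → con 0ℚ :+ con ½ :* e := e :- con ½ :* e) refl η ⟩
        η ℚ.- ½ ℚ.* η                         ≤⟨ ≤+⇒-≤ η (½ ℚ.* η) (begin
          η                                       ≤⟨ η≤t ⟩
          r ℚ.+ 1/n                               ≤⟨ ℚ.+-monoʳ-≤ r 1/n≤½η ⟩
          r ℚ.+ ½ ℚ.* η                           ≡⟨ ℚ.+-comm r _ ⟩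
          ½ ℚ.* η ℚ.+ r                           ∎) ⟩
        r                                     ∎
    where
    open ℚSolver.+-*-Solver
    open ℚ.≤-Reasoning
    η = δ ℚ.⊓ 1ℚ
    0<η : 0ℚ ℚ.< η
    0<η with ℚ.≤-total δ 1ℚ
    ... | inj₁ δ≤1 = subst (0ℚ ℚ.<_) (sym (ℚ.p≤q⇒p⊓q≡p δ≤1)) 0<δ
    ... | inj₂ 1≤δ = subst (0ℚ ℚ.<_) (sym (ℚ.p≥q⇒p⊓q≡q 1≤δ)) (ℚ.positive⁻¹ 1ℚ)
    η²≤δ : η ℚ.* η ℚ.≤ δ
    η²≤δ = ℚ.≤-trans (*-mono (ℚ.<⇒≤ 0<η) (ℚ.nonNegative⁻¹ 1ℚ) (ℚ.p⊓q≤p δ 1ℚ) (ℚ.p⊓q≤q δ 1ℚ))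
                     (ℚ.≤-reflexive (ℚ.*-identityʳ δ))
    A  = proj₁ (archimedean 1 (½ ℚ.* η) (half 0<η))
    fr = proj₂ (archimedean 1 (½ ℚ.* η) (half 0<η))

  π-pos : 0ℝ < π
  π-pos = mk< h (0<frac 1 2) $ 16 , λ n 16≤n → begin
    0ℚ ℚ.+ h                    ≡⟨ solve 1 (λ h → con 0ℚ :+ h := h :+ h :- h) refl h ⟩
    h ℚ.+ h ℚ.- h               ≤⟨ ≤+⇒-≤ (h ℚ.+ h) h (begin
      h ℚ.+ h                       ≡⟨ frac-+ 1 2 1 2 ⟩
      π-seq 1                       ≤⟨ π-seq-≤ 1 n ⟩
      π-seq n ℚ.+ frac 8 (suc n)    ≤⟨ ℚ.+-monoʳ-≤ (π-seq n) (8/n≤h n 16≤n) ⟩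
      π-seq n ℚ.+ h                 ≡⟨ ℚ.+-comm (π-seq n) h ⟩
      h ℚ.+ π-seq n                 ∎) ⟩
    π-seq n                     ∎
    where
    open ℚSolver.+-*-Solver
    open ℚ.≤-Reasoning
    h = frac 1 2
    8/n≤h : ∀ n → 16 ℕ.≤ n → frac 8 (suc n) ℚ.≤ h
    8/n≤h n 16≤n = frac-≤ 8 (suc n) 1 2
      (ℕ.≤-trans (ℕ.m≤n⇒m≤1+n 16≤n) (ℕ.≤-reflexive (sym (ℕ.*-identityˡ (suc n)))))

-- Positive indices only, as the sequences of interest divide by √ n.

Sequence⁺ : Set
Sequence⁺ = (n : ℕ) → .{{NonZero n}} → ℝ

infix 4 _≐_+o_

-- f n = g n + o (h n) as n → ∞.

_≐_+o_ : Sequence⁺ → Sequence⁺ → Sequence⁺ → Set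
f ≐ g +o h = ∀ (ε : ℝ) → 0ℝ < ε →
  ∃ λ N → ∀ n → .{{_ : NonZero n}} → N ℕ.≤ n → ∣ f n - g n ∣ ≤ ε * ∣ h n ∣

{-# OPTIONS --safe #-}

-- Write c n for the central binomial coefficient.  Decomposing lattice paths by
-- the point where they leave the boundary gives B(n,n) = 2 Σ_{1≤j≤n} F_j w_j with
-- w_j = C(2n−1−j, n−1).  Since F_j = 2 F_{j+2} − F_{j+3} and w_j is almost 2 w_{j+1},
-- summation by parts leaves 2 · 6 w_1 = 12 c (n − 1) = 3 c n (1 + O(1/n)).
--
-- For c n ~ 4ⁿ / √(π n), follow Wästlund: with a k = c k / 4ᵏ and s k = Σ_{i<k} a i =
-- 2 k a k, the staircase made of the rectangles [s i , s (i+1)] × [s j , s (j+1)]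
-- with i + j < n has area n, while its corners lie at distance s n (1 + O(1/n)) from the origin.
-- Hence π (s n)² / 4 ~ n.  Since π is defined by counting grid squares in a quarter
-- disc, the comparison is a comparison of counts.

module Submission where

open import Defs using (frac; π-seq; fib; binomiacci; ∑; [_]₁; squaresInQuarterDisc; module QuarterDisc; module RationalLemmas)
open import Data.Nat.Base as ℕ using (ℕ; zero; suc; NonZero; z≤n; s≤s; _^_)
import Data.Nat.Properties as ℕ
import Data.Nat.Solver as ℕSolver
open import Data.Product.Base using (_×_; _,_; proj₁; proj₂)
open import Data.Rational.Base as ℚ using (ℚ; 0ℚ; 1ℚ)
import Data.Rational.Properties as ℚ
import Data.Rational.Solver as ℚSolver
open import Data.Sum.Base using (inj₁; inj₂)
open import Function.Base using (_∘_)
open import Relation.Binary.PropositionalEquality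
open import Relation.Nullary using (Dec; yes; no; ¬_; contradiction)

-- The staircase fixes a grid of radius K near 2 n c n, whereas `π-seq m` counts on an unrelated
-- grid of radius m + 1, with m going to infinity while n stays fixed. `QuarterDisc.compare` passes
-- between the grids in both directions, losing twice the radius of the grid on the larger side of
-- the inequality. When that radius is K, the loss is small against the area; when it is m + 1, it
-- is small once m + 1 ≥ 8 n². That the corners stay close to a circle rests on two opposite
-- monotonicities: (s k)² / k increases and (s k)² / (2 k - 1) decreases, so (s k)² + (s (n - k))²
-- hardly depends on k. Up to the last estimate all inequalities are squared and cleared of
-- denominators: they yield (c n)² π n = 16ⁿ (1 + O(1/n)), and roots are extracted only then.

-- Cauchy products of sequences of naturals.

module Convolution where
  open import Data.Nat.Base using (_+_; _*_; _∸_)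
  open ℕSolver.+-*-Solver

  -- The Cauchy product, the sum of f i · g j over i + j = n. Peeling off `f 0` and shifting f
  -- avoids subtraction of indices and lets inductions on n run over all f at once.
  conv : (f g : ℕ → ℕ) → ℕ → ℕ
  conv f g zero    = f 0 * g 0
  conv f g (suc n) = f 0 * g (suc n) + conv (f ∘ suc) g n

  conv-last : ∀ f g n → conv f g (suc n) ≡ conv f (g ∘ suc) n + f (suc n) * g 0
  conv-last f g zero    = refl
  conv-last f g (suc n) = trans (cong (f 0 * g (suc (suc n)) +_) (conv-last (f ∘ suc) g n))
    (sym (ℕ.+-assoc (f 0 * g (suc (suc n))) _ _))

  conv-comm : ∀ f g n → conv f g n ≡ conv g f n
  conv-comm f g zero    = ℕ.*-comm (f 0) (g 0)
  conv-comm f g (suc n) = begin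
    f 0 * g (suc n) + conv (f ∘ suc) g n  ≡⟨ cong₂ _+_ (ℕ.*-comm (f 0) (g (suc n))) (conv-comm (f ∘ suc) g n) ⟩
    g (suc n) * f 0 + conv g (f ∘ suc) n  ≡⟨ ℕ.+-comm (g (suc n) * f 0) _ ⟩
    conv g (f ∘ suc) n + g (suc n) * f 0  ≡⟨ conv-last g f n ⟨
    conv g f (suc n)                      ∎
    where open ≡-Reasoning

  conv-congʳ : ∀ f {g h} n → (∀ k → g k ≡ h k) → conv f g n ≡ conv f h n
  conv-congʳ f zero    g≗h = cong (f 0 *_) (g≗h 0)
  conv-congʳ f (suc n) g≗h = cong₂ (λ x y → f 0 * x + y) (g≗h (suc n)) (conv-congʳ (f ∘ suc) n g≗h)

  conv-linearʳ : ∀ f c g h n → conv f (λ k → c * (g k + h k)) n ≡ c * (conv f g n + conv f h n)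
  conv-linearʳ f c g h zero    =
    solve 4 (λ f c g h → f :* (c :* (g :+ h)) := c :* (f :* g :+ f :* h)) refl (f 0) c (g 0) (h 0)
  conv-linearʳ f c g h (suc n) =
    trans (cong (f 0 * (c * (g (suc n) + h (suc n))) +_) (conv-linearʳ (f ∘ suc) c g h n))
    (solve 6 (λ f c g h x y → f :* (c :* (g :+ h)) :+ c :* (x :+ y) := c :* (f :* g :+ x :+ (f :* h :+ y)))
      refl (f 0) c (g (suc n)) (h (suc n)) (conv (f ∘ suc) g n) (conv (f ∘ suc) h n))

  conv-+ˡ : ∀ f g h n → conv (λ k → f k + g k) h n ≡ conv f h n + conv g h n
  conv-+ˡ f g h zero    = ℕ.*-distribʳ-+ (h 0) (f 0) (g 0)
  conv-+ˡ f g h (suc n) =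
    trans (cong ((f 0 + g 0) * h (suc n) +_) (conv-+ˡ (f ∘ suc) (g ∘ suc) h n))
    (solve 5 (λ f g h x y → (f :+ g) :* h :+ (x :+ y) := f :* h :+ x :+ (g :* h :+ y))
      refl (f 0) (g 0) (h (suc n)) (conv (f ∘ suc) h n) (conv (g ∘ suc) h n))

  -- The product rule for x · d/dx on generating functions.
  conv-leibniz : ∀ f g n → n * conv f g n ≡ conv (λ k → k * f k) g n + conv f (λ k → k * g k) n
  conv-leibniz f g zero    = sym (ℕ.*-zeroʳ (f 0))
  conv-leibniz f g (suc n) = begin
    suc n * (f 0 * g (suc n) + conv f′ g n)
      ≡⟨ solve 4 (λ n a b x → (con 1 :+ n) :* (a :* b :+ x) := x :+ n :* x :+ a :* ((con 1 :+ n) :* b))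
           refl n (f 0) (g (suc n)) (conv f′ g n) ⟩
    conv f′ g n + n * conv f′ g n + f 0 * (suc n * g (suc n))
      ≡⟨ cong (λ z → conv f′ g n + z + f 0 * (suc n * g (suc n))) (conv-leibniz f′ g n) ⟩
    conv f′ g n + (conv (λ k → k * f′ k) g n + conv f′ (λ k → k * g k) n) + f 0 * (suc n * g (suc n))
      ≡⟨ solve 4 (λ a b c d → a :+ (b :+ c) :+ d := a :+ b :+ (d :+ c))
           refl (conv f′ g n) (conv (λ k → k * f′ k) g n) (conv f′ (λ k → k * g k) n) (f 0 * (suc n * g (suc n))) ⟩
    conv f′ g n + conv (λ k → k * f′ k) g n + (f 0 * (suc n * g (suc n)) + conv f′ (λ k → k * g k) n)
      ≡⟨ cong (_+ (f 0 * (suc n * g (suc n)) + conv f′ (λ k → k * g k) n)) (conv-+ˡ f′ (λ k → k * f′ k) g n) ⟨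
    conv (λ k → k * f k) g (suc n) + conv f (λ k → k * g k) (suc n) ∎
    where
    open ≡-Reasoning
    f′ = f ∘ suc

  conv-∑ : ∀ f g n → conv f g n ≡ ∑ (suc n) (λ k → f k * g (n ∸ k))
  conv-∑ f g zero    = refl
  conv-∑ f g (suc n) = trans (cong (f 0 * g (suc n) +_) (conv-∑ (f ∘ suc) g n))
    (sym (QuarterDisc.∑-head (suc n) (λ k → f k * g (suc n ∸ k))))

open Convolution

-- Binomial coefficients as lattice path counts.

module LatticePaths where
  open import Data.Nat.Base using (_+_; _*_; _≤_)
  open ℕSolver.+-*-Solver

  -- The binomial coefficient C(a + b, a), given by the same recursion as `binomiacci` so that the
  -- two unfold in step.
  paths : ℕ → ℕ → ℕ
  paths zero    b       = 1
  paths (suc a) zero    = 1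
  paths (suc a) (suc b) = paths (suc a) b + paths a (suc b)

  central : ℕ → ℕ
  central n = paths n n

  paths-zeroʳ : ∀ a → paths a 0 ≡ 1
  paths-zeroʳ zero    = refl
  paths-zeroʳ (suc a) = refl

  paths-comm : ∀ a b → paths a b ≡ paths b a
  paths-comm zero    b       = sym (paths-zeroʳ b)
  paths-comm (suc a) zero    = refl
  paths-comm (suc a) (suc b) =
    trans (cong₂ _+_ (paths-comm (suc a) b) (paths-comm a (suc b))) (ℕ.+-comm (paths b (suc a)) _)

  -- The source of every ratio estimate below. After Pascal's rule both summands become multiples of
  -- `paths (suc a) b`, the second by exchanging one absorption at (a, b) for the other; `absorbˡ`
  -- is the mirror image.
  absorbʳ : ∀ a b → suc b * paths a (suc b) ≡ suc (a + b) * paths a b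
  absorbˡ : ∀ a b → suc a * paths (suc a) b ≡ suc (a + b) * paths a b

  absorbʳ zero    b = refl
  absorbʳ (suc a) b = begin
    suc b * (paths (suc a) b + paths a (suc b))
      ≡⟨ ℕ.*-distribˡ-+ (suc b) (paths (suc a) b) _ ⟩
    suc b * paths (suc a) b + suc b * paths a (suc b)
      ≡⟨ cong (suc b * paths (suc a) b +_) (trans (absorbʳ a b) (sym (absorbˡ a b))) ⟩
    suc b * paths (suc a) b + suc a * paths (suc a) b
      ≡⟨ solve 3 (λ a b p → (con 1 :+ b) :* p :+ (con 1 :+ a) :* p := (con 1 :+ (con 1 :+ a :+ b)) :* p)
           refl a b (paths (suc a) b) ⟩
    suc (suc a + b) * paths (suc a) b ∎
    where open ≡-Reasoning

  absorbˡ a b = begin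
    suc a * paths (suc a) b       ≡⟨ cong (suc a *_) (paths-comm (suc a) b) ⟩
    suc a * paths b (suc a)       ≡⟨ absorbʳ b a ⟩
    suc (b + a) * paths b a       ≡⟨ cong₂ (λ m p → suc m * p) (ℕ.+-comm b a) (paths-comm b a) ⟩
    suc (a + b) * paths a b       ∎
    where open ≡-Reasoning

  central-suc : ∀ n → suc n * central (suc n) ≡ 2 * (suc (2 * n) * central n)
  central-suc n = begin
    suc n * (paths (suc n) n + paths n (suc n))
      ≡⟨ cong (λ p → suc n * (paths (suc n) n + p)) (paths-comm n (suc n)) ⟩
    suc n * (paths (suc n) n + paths (suc n) n)
      ≡⟨ solve 2 (λ n p → n :* (p :+ p) := con 2 :* (n :* p)) refl (suc n) (paths (suc n) n) ⟩
    2 * (suc n * paths (suc n) n)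
      ≡⟨ cong (2 *_) (absorbˡ n n) ⟩
    2 * (suc (n + n) * central n)
      ≡⟨ cong (λ m → 2 * (suc (n + m) * central n)) (sym (ℕ.+-identityʳ n)) ⟩
    2 * (suc (2 * n) * central n) ∎
    where open ≡-Reasoning

  paths-pos : ∀ a b → 1 ≤ paths a b
  paths-pos zero    b       = ℕ.≤-refl
  paths-pos (suc a) zero    = ℕ.≤-refl
  paths-pos (suc a) (suc b) = ℕ.≤-trans (paths-pos (suc a) b) (ℕ.m≤m+n _ _)

  central≤4^ : ∀ n → central n ≤ 4 ^ n
  central≤4^ zero    = ℕ.≤-refl
  central≤4^ (suc n) = ℕ.*-cancelˡ-≤ (suc n) (begin
    suc n * central (suc n)          ≡⟨ central-suc n ⟩
    2 * (suc (2 * n) * central n)    ≤⟨ ℕ.*-monoʳ-≤ 2 (ℕ.*-mono-≤ (ℕ.n≤1+n (suc (2 * n))) (central≤4^ n)) ⟩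
    2 * (suc (suc (2 * n)) * 4 ^ n)
      ≡⟨ solve 2 (λ n p → con 2 :* ((con 2 :+ con 2 :* n) :* p) := (con 1 :+ n) :* (con 4 :* p)) refl n (4 ^ n) ⟩
    suc n * 4 ^ suc n                ∎)
    where open ℕ.≤-Reasoning

open LatticePaths

-- Central Binomiacci numbers against central binomial coefficients.

module BinomiacciEstimate where
  open import Data.Nat.Base using (_+_; _*_; _≤_)
  open ℕSolver.+-*-Solver

  -- The contribution of one edge to `binomiacci (suc a) (suc n)`: a path leaves the entry
  -- `fib (suc k)` by a forced step into the interior and then has a and n - k steps left in the two
  -- directions. The corner never feeds the interior, hence `fib ∘ suc`.
  boundaryPart : ℕ → ℕ → ℕ
  boundaryPart a n = conv (fib ∘ suc) (paths a) n

  -- Pascal's rule term by term; the last term has no predecessor on its own row and matches because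
  -- `paths (suc a) 0` and `paths a 0` are both 1.
  conv-paths : ∀ f a n → conv f (paths (suc a)) (suc n) ≡ conv f (paths (suc a)) n + conv f (paths a) (suc n)
  conv-paths f a zero    rewrite paths-zeroʳ a =
    solve 3 (λ x y p → x :* (con 1 :+ p) :+ y :* con 1 := x :* con 1 :+ (x :* p :+ y :* con 1))
      refl (f 0) (f 1) (paths a 1)
  conv-paths f a (suc n) =
    trans (cong (f 0 * (paths (suc a) (suc n) + paths a (suc (suc n))) +_) (conv-paths (f ∘ suc) a n))
    (solve 5 (λ x p q u v → x :* (p :+ q) :+ (u :+ v) := x :* p :+ u :+ (x :* q :+ v))
      refl (f 0) (paths (suc a) (suc n)) (paths a (suc (suc n)))
      (conv (f ∘ suc) (paths (suc a)) n) (conv (f ∘ suc) (paths a) (suc n)))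

  boundaryPart-zero : ∀ n → boundaryPart 0 (suc n) ≡ boundaryPart 0 n + fib (suc (suc n))
  boundaryPart-zero n = trans (conv-last (fib ∘ suc) (paths 0) n)
    (cong (boundaryPart 0 n +_) (ℕ.*-identityʳ _))

  boundaryPart-zeroʳ : ∀ a → boundaryPart a 0 ≡ 1
  boundaryPart-zeroʳ a = trans (ℕ.+-identityʳ _) (paths-zeroʳ a)

  binomiacci-zeroʳ : ∀ k → binomiacci k 0 ≡ fib k
  binomiacci-zeroʳ zero    = refl
  binomiacci-zeroʳ (suc k) = refl

  binomiacci-boundary : ∀ a n → binomiacci (suc a) (suc n) ≡ boundaryPart a n + boundaryPart n a
  binomiacci-boundary zero zero = refl
  binomiacci-boundary zero (suc n) = begin
    binomiacci 1 (suc n) + fib (2 + n)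
      ≡⟨ cong (_+ fib (2 + n)) (binomiacci-boundary zero n) ⟩
    boundaryPart 0 n + boundaryPart n 0 + fib (2 + n)
      ≡⟨ cong (λ z → boundaryPart 0 n + z + fib (2 + n)) (boundaryPart-zeroʳ n) ⟩
    boundaryPart 0 n + 1 + fib (2 + n)
      ≡⟨ solve 2 (λ x z → x :+ con 1 :+ z := x :+ z :+ con 1) refl (boundaryPart 0 n) (fib (2 + n)) ⟩
    boundaryPart 0 n + fib (2 + n) + 1
      ≡⟨ cong (_+ 1) (boundaryPart-zero n) ⟨
    boundaryPart 0 (suc n) + boundaryPart (suc n) 0 ∎
    where open ≡-Reasoning
  binomiacci-boundary (suc a) zero = begin
    fib (2 + a) + binomiacci (suc a) 1
      ≡⟨ cong (fib (2 + a) +_) (binomiacci-boundary a zero) ⟩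
    fib (2 + a) + (boundaryPart a 0 + boundaryPart 0 a)
      ≡⟨ cong (λ z → fib (2 + a) + (z + boundaryPart 0 a)) (boundaryPart-zeroʳ a) ⟩
    fib (2 + a) + (1 + boundaryPart 0 a)
      ≡⟨ solve 2 (λ x z → z :+ (con 1 :+ x) := con 1 :+ (x :+ z)) refl (boundaryPart 0 a) (fib (2 + a)) ⟩
    1 + (boundaryPart 0 a + fib (2 + a))
      ≡⟨ cong (1 +_) (boundaryPart-zero a) ⟨
    boundaryPart (suc a) 0 + boundaryPart 0 (suc a) ∎
    where open ≡-Reasoning
  binomiacci-boundary (suc a) (suc n) = begin
    binomiacci (2 + a) (suc n) + binomiacci (suc a) (2 + n)
      ≡⟨ cong₂ _+_ (binomiacci-boundary (suc a) n) (binomiacci-boundary a (suc n)) ⟩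
    boundaryPart (suc a) n + boundaryPart n (suc a) + (boundaryPart a (suc n) + boundaryPart (suc n) a)
      ≡⟨ solve 4 (λ p q r s → p :+ q :+ (r :+ s) := p :+ r :+ (s :+ q)) refl
           (boundaryPart (suc a) n) (boundaryPart n (suc a)) (boundaryPart a (suc n)) (boundaryPart (suc n) a) ⟩
    boundaryPart (suc a) n + boundaryPart a (suc n) + (boundaryPart (suc n) a + boundaryPart n (suc a))
      ≡⟨ cong₂ _+_ (conv-paths (fib ∘ suc) a n) (conv-paths (fib ∘ suc) n a) ⟨
    boundaryPart (suc a) (suc n) + boundaryPart (suc n) (suc a) ∎
    where open ≡-Reasoning

  -- A class closed under `f ∘ suc`, as induction along `conv` requires.
  FibonacciLike : (ℕ → ℕ) → Set
  FibonacciLike f = ∀ k → f (2 + k) ≡ f (1 + k) + f k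

  telescope : ∀ f → FibonacciLike f → ∀ k → f k + f (3 + k) ≡ 2 * f (2 + k)
  telescope f rec k rewrite rec (suc k) | rec k =
    solve 2 (λ x y → x :+ (y :+ x :+ y) := con 2 :* (y :+ x)) refl (f k) (f (suc k))

  mono-suc : ∀ f → FibonacciLike f → ∀ k → f (1 + k) ≤ f (2 + k)
  mono-suc f rec k = ℕ.≤-trans (ℕ.m≤m+n _ (f k)) (ℕ.≤-reflexive (sym (rec k)))

  -- By absorption the ratio of the two counts is (a + n + 1) / (n + 1), which is exactly 2 at a = n
  -- + 1.
  paths-double : ∀ a n → suc n ≤ a → 2 * paths a n ≤ paths a (suc n)
  paths-double a n n<a = ℕ.*-cancelˡ-≤ (suc n) (begin
    suc n * (2 * paths a n)
      ≡⟨ solve 2 (λ n p → (con 1 :+ n) :* (con 2 :* p) := (con 1 :+ (con 1 :+ n :+ n)) :* p) refl n (paths a n) ⟩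
    suc (suc n + n) * paths a n   ≤⟨ ℕ.*-monoˡ-≤ (paths a n) (ℕ.s≤s (ℕ.+-monoˡ-≤ n n<a)) ⟩
    suc (a + n) * paths a n       ≡⟨ absorbʳ a n ⟨
    suc n * paths a (suc n)       ∎)
    where open ℕ.≤-Reasoning

  -- With p and q the two counts, q - 2 p = i q / (a + n + 1). Weakening the denominator to `a`
  -- makes it independent of n, so one factor `a` serves the whole induction in `conv-fib-≥`.
  paths-almost-double : ∀ n i → let a = suc n + i in
    a * paths a (suc n) ≤ a * (2 * paths a n) + i * paths a (suc n)
  paths-almost-double n i = ℕ.*-cancelˡ-≤ (suc (a + n)) (begin
    suc (a + n) * (a * q)
      ≡⟨ solve 3 (λ n i q → let a = con 1 :+ n :+ i in
           (con 1 :+ (a :+ n)) :* (a :* q) := a :* (con 2 :* ((con 1 :+ n) :* q)) :+ i :* a :* q) refl n i q ⟩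
    a * (2 * (suc n * q)) + i * a * q
      ≤⟨ ℕ.+-monoʳ-≤ _ (ℕ.*-monoˡ-≤ q (ℕ.*-monoʳ-≤ i (ℕ.m≤n⇒m≤1+n (ℕ.m≤m+n a n)))) ⟩
    a * (2 * (suc n * q)) + i * suc (a + n) * q
      ≡⟨ cong (λ z → a * (2 * z) + i * suc (a + n) * q) (absorbʳ a n) ⟩
    a * (2 * (suc (a + n) * p)) + i * suc (a + n) * q
      ≡⟨ solve 5 (λ a p i q s → a :* (con 2 :* (s :* p)) :+ i :* s :* q := s :* (a :* (con 2 :* p) :+ i :* q))
           refl a p i q (suc (a + n)) ⟩
    suc (a + n) * (a * (2 * p) + i * q) ∎)
    where
    open ℕ.≤-Reasoning
    a = suc n + i
    p = paths a n
    q = paths a (suc n)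

  -- Summation by parts with f k = 2 f (k + 2) − f (k + 3); the loss, from paths a not
  -- quite doubling, is again summed by telescoping, whence f 5 and f 8.

  conv-fib-≤ : ∀ f → FibonacciLike f → ∀ a n → n ≤ a → conv f (paths a) n ≤ 2 * f 2 * paths a n
  conv-fib-≤ f rec a zero n≤a = ℕ.*-monoˡ-≤ (paths a 0) (begin
    f 0          ≤⟨ ℕ.m≤m+n (f 0) (f 3) ⟩
    f 0 + f 3    ≡⟨ telescope f rec 0 ⟩
    2 * f 2      ∎)
    where open ℕ.≤-Reasoning
  conv-fib-≤ f rec a (suc n) n<a = begin
    f 0 * q + conv (f ∘ suc) (paths a) n  ≤⟨ ℕ.+-monoʳ-≤ (f 0 * q) (conv-fib-≤ (f ∘ suc) (rec ∘ suc) a n (ℕ.<⇒≤ n<a)) ⟩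
    f 0 * q + 2 * f 3 * p
      ≡⟨ solve 4 (λ x q y p → x :* q :+ con 2 :* y :* p := x :* q :+ y :* (con 2 :* p)) refl (f 0) q (f 3) p ⟩
    f 0 * q + f 3 * (2 * p)               ≤⟨ ℕ.+-monoʳ-≤ (f 0 * q) (ℕ.*-monoʳ-≤ (f 3) (paths-double a n n<a)) ⟩
    f 0 * q + f 3 * q                     ≡⟨ ℕ.*-distribʳ-+ q (f 0) (f 3) ⟨
    (f 0 + f 3) * q                       ≡⟨ cong (_* q) (telescope f rec 0) ⟩
    2 * f 2 * q                           ∎
    where
    open ℕ.≤-Reasoning
    p = paths a n
    q = paths a (suc n)

  conv-fib-≥ : ∀ f → FibonacciLike f → ∀ a n i → a ≡ n + i →
    a * (2 * f 2 * paths a n) ≤ a * conv f (paths a) n + (2 * i * f 5 + 2 * f 8) * paths a n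
  conv-fib-≥ f rec a zero i refl = begin
    a * (2 * f 2 * p)
      -- At n = 0 the offset i is `a` itself, so the loss term alone exceeds the left side.
      ≤⟨ ℕ.*-monoʳ-≤ a (ℕ.*-monoˡ-≤ p (ℕ.*-monoʳ-≤ 2 (ℕ.≤-trans (mono-suc f rec 1) (ℕ.≤-trans (mono-suc f rec 2) (mono-suc f rec 3))))) ⟩
    a * (2 * f 5 * p)
      ≤⟨ ℕ.m≤n+m _ (a * (f 0 * p) + 2 * f 8 * p) ⟩
    a * (f 0 * p) + 2 * f 8 * p + a * (2 * f 5 * p)
      ≡⟨ solve 5 (λ a x y z p → a :* (x :* p) :+ con 2 :* z :* p :+ a :* (con 2 :* y :* p)
                              := a :* (x :* p) :+ (con 2 :* a :* y :+ con 2 :* z) :* p) refl a (f 0) (f 5) (f 8) p ⟩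
    a * (f 0 * p) + (2 * a * f 5 + 2 * f 8) * p ∎
    where
    open ℕ.≤-Reasoning
    p = paths a 0
  conv-fib-≥ f rec a (suc n) i refl = begin
    a * (2 * f 2 * q)
      ≡⟨ cong (λ z → a * (z * q)) (telescope f rec 0) ⟨
    a * ((f 0 + f 3) * q)
      ≡⟨ solve 4 (λ a x y q → a :* ((x :+ y) :* q) := a :* (x :* q) :+ y :* (a :* q)) refl a (f 0) (f 3) q ⟩
    a * (f 0 * q) + f 3 * (a * q)
      ≤⟨ ℕ.+-monoʳ-≤ (a * (f 0 * q)) (begin
        f 3 * (a * q)
          ≤⟨ ℕ.*-monoʳ-≤ (f 3) (paths-almost-double n i) ⟩
        f 3 * (a * (2 * p) + i * q)
          ≡⟨ solve 5 (λ y a p i q → y :* (a :* (con 2 :* p) :+ i :* q) := a :* (con 2 :* y :* p) :+ i :* y :* q)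
               refl (f 3) a p i q ⟩
        a * (2 * f 3 * p) + i * f 3 * q
          -- The tail keeps `a` and lowers n, so it lies one further from the diagonal: `suc i`.
          ≤⟨ ℕ.+-monoˡ-≤ (i * f 3 * q) (conv-fib-≥ (f ∘ suc) (rec ∘ suc) a n (suc i) (sym (ℕ.+-suc n i))) ⟩
        a * t + (2 * suc i * f 6 + 2 * f 9) * p + i * f 3 * q
          ≡⟨ solve 8 (λ a t i u v p y q →
               a :* t :+ (con 2 :* (con 1 :+ i) :* u :+ con 2 :* v) :* p :+ i :* y :* q
               := a :* t :+ i :* y :* q :+ ((con 1 :+ i) :* u :+ v) :* (con 2 :* p))
               refl a t i (f 6) (f 9) p (f 3) q ⟩
        a * t + i * f 3 * q + (suc i * f 6 + f 9) * (2 * p)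
          ≤⟨ ℕ.+-monoʳ-≤ (a * t + i * f 3 * q) (ℕ.*-monoʳ-≤ (suc i * f 6 + f 9) (paths-double a n (ℕ.m≤m+n (suc n) i))) ⟩
        a * t + i * f 3 * q + (suc i * f 6 + f 9) * q
          ≡⟨ solve 7 (λ a t i u v y q →
               a :* t :+ i :* y :* q :+ ((con 1 :+ i) :* u :+ v) :* q
               := a :* t :+ (i :* (y :+ u) :+ (u :+ v)) :* q)
               refl a t i (f 6) (f 9) (f 3) q ⟩
        a * t + (i * (f 3 + f 6) + (f 6 + f 9)) * q
          -- The recursive loss, halved by passing from p to q, and the new loss `i * f 3` add up to
          -- the claimed shape: `telescope` turns f 3 + f 6 into 2 f 5 and f 6 + f 9 into 2 f 8.
          ≡⟨ cong₂ (λ y z → a * t + (i * y + z) * q) (telescope f rec 3) (telescope f rec 6) ⟩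
        a * t + (i * (2 * f 5) + 2 * f 8) * q ∎) ⟩
    a * (f 0 * q) + (a * t + (i * (2 * f 5) + 2 * f 8) * q)
      ≡⟨ solve 7 (λ a x q t i y z →
           a :* (x :* q) :+ (a :* t :+ (i :* (con 2 :* y) :+ con 2 :* z) :* q)
           := a :* (x :* q :+ t) :+ (con 2 :* i :* y :+ con 2 :* z) :* q)
           refl a (f 0) q t i (f 5) (f 8) ⟩
    a * (f 0 * q + t) + (2 * i * f 5 + 2 * f 8) * q ∎
    where
    open ℕ.≤-Reasoning
    p = paths a n
    q = paths a (suc n)
    t = conv (f ∘ suc) (paths a) n

  binomiacci-diagonal : ∀ a → binomiacci (suc a) (suc a) ≡ 2 * boundaryPart a a
  binomiacci-diagonal a = trans (binomiacci-boundary a a) (cong (boundaryPart a a +_) (sym (ℕ.+-identityʳ _)))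

  binomiacci-≤ : ∀ a → binomiacci (suc a) (suc a) ≤ 12 * central a
  binomiacci-≤ a = begin
    binomiacci (suc a) (suc a)   ≡⟨ binomiacci-diagonal a ⟩
    2 * boundaryPart a a         ≤⟨ ℕ.*-monoʳ-≤ 2 (conv-fib-≤ (fib ∘ suc) (λ _ → refl) a a ℕ.≤-refl) ⟩
    2 * (6 * central a)          ≡⟨ ℕ.*-assoc 2 6 (central a) ⟨
    12 * central a               ∎
    where open ℕ.≤-Reasoning

  binomiacci-≥ : ∀ a → a * (12 * central a) ≤ a * binomiacci (suc a) (suc a) + 220 * central a
  binomiacci-≥ a = begin
    a * (12 * central a)
      ≡⟨ solve 2 (λ a c → a :* (con 12 :* c) := con 2 :* (a :* (con 6 :* c))) refl a (central a) ⟩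
    2 * (a * (6 * central a))
      -- On the diagonal i = 0, which leaves the loss 2 · `fib 9` = 110.
      ≤⟨ ℕ.*-monoʳ-≤ 2 (conv-fib-≥ (fib ∘ suc) (λ _ → refl) a a 0 (sym (ℕ.+-identityʳ a))) ⟩
    2 * (a * boundaryPart a a + 110 * central a)
      ≡⟨ solve 3 (λ a t c → con 2 :* (a :* t :+ con 110 :* c) := a :* (con 2 :* t) :+ con 220 :* c)
           refl a (boundaryPart a a) (central a) ⟩
    a * (2 * boundaryPart a a) + 220 * central a
      ≡⟨ cong (λ b → a * b + 220 * central a) (binomiacci-diagonal a) ⟨
    a * binomiacci (suc a) (suc a) + 220 * central a ∎
    where open ℕ.≤-Reasoning

  central-mono : ∀ n → central n ≤ central (suc n)
  central-mono n = ℕ.*-cancelˡ-≤ (suc n) (begin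
    suc n * central n                ≤⟨ ℕ.m≤n+m _ ((3 * n + 1) * central n) ⟩
    (3 * n + 1) * central n + suc n * central n
      ≡⟨ solve 2 (λ n c → (con 3 :* n :+ con 1) :* c :+ (con 1 :+ n) :* c
                        := con 2 :* ((con 1 :+ con 2 :* n) :* c)) refl n (central n) ⟩
    2 * (suc (2 * n) * central n)    ≡⟨ central-suc n ⟨
    suc n * central (suc n)          ∎)
    where open ℕ.≤-Reasoning

  3n-central : ∀ a → 3 * (suc a * central (suc a)) ≡ (12 * a + 6) * central a
  3n-central a = trans (cong (3 *_) (central-suc a))
    (solve 2 (λ a c → con 3 :* (con 2 :* ((con 1 :+ con 2 :* a) :* c)) := (con 12 :* a :+ con 6) :* c)
      refl a (central a))

  binomiacci-≤-central : ∀ n .{{_ : NonZero n}} →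
    n * binomiacci n n ≤ 3 * (n * central n) + 226 * central n
  binomiacci-≤-central n@(suc a) = begin
    n * binomiacci n n                    ≤⟨ ℕ.*-monoʳ-≤ n (binomiacci-≤ a) ⟩
    n * (12 * central a)
      ≡⟨ solve 2 (λ a c → (con 1 :+ a) :* (con 12 :* c) := (con 12 :* a :+ con 6) :* c :+ con 6 :* c) refl a (central a) ⟩
    (12 * a + 6) * central a + 6 * central a
      -- The slack 6 is raised to 226 = 220 + 6, the slack of the lower bound, so that both bounds
      -- share one constant.
      ≤⟨ ℕ.+-monoʳ-≤ ((12 * a + 6) * central a) (ℕ.*-mono-≤ (ℕ.m≤m+n 6 220) (central-mono a)) ⟩
    (12 * a + 6) * central a + 226 * central n
      ≡⟨ cong (_+ 226 * central n) (3n-central a) ⟨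
    3 * (n * central n) + 226 * central n ∎
    where open ℕ.≤-Reasoning

  binomiacci-≥-central : ∀ n .{{_ : NonZero n}} →
    3 * (n * central n) ≤ n * binomiacci n n + 226 * central n
  binomiacci-≥-central n@(suc a) = begin
    3 * (n * central n)                   ≡⟨ 3n-central a ⟩
    (12 * a + 6) * central a
      ≡⟨ solve 2 (λ a c → (con 12 :* a :+ con 6) :* c := a :* (con 12 :* c) :+ con 6 :* c) refl a (central a) ⟩
    a * (12 * central a) + 6 * central a
      ≤⟨ ℕ.+-monoˡ-≤ (6 * central a) (binomiacci-≥ a) ⟩
    a * binomiacci n n + 220 * central a + 6 * central a
      ≡⟨ trans (ℕ.+-assoc (a * binomiacci n n) _ _) (cong (a * binomiacci n n +_) (sym (ℕ.*-distribʳ-+ (central a) 220 6))) ⟩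
    a * binomiacci n n + 226 * central a
      ≤⟨ ℕ.+-mono-≤ (ℕ.*-monoˡ-≤ (binomiacci n n) (ℕ.n≤1+n a)) (ℕ.*-monoʳ-≤ 226 (central-mono a)) ⟩
    n * binomiacci n n + 226 * central n  ∎
    where open ℕ.≤-Reasoning

open BinomiacciEstimate using (binomiacci-≤-central; binomiacci-≥-central)

-- Staircases compared with grid squares in a quarter disc.

module Staircase where
  open import Data.Nat.Base using (_+_; _*_; _∸_; _≤_; _<_)
  open QuarterDisc

  ∑-cong : ∀ n {f g : ℕ → ℕ} → (∀ i → i < n → f i ≡ g i) → ∑ n f ≡ ∑ n g
  ∑-cong zero    f≗g = refl
  ∑-cong (suc n) f≗g = cong₂ _+_ (∑-cong n λ i i<n → f≗g i (ℕ.m<n⇒m<1+n i<n)) (f≗g n ℕ.≤-refl)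

  ∑-extend : ∀ {m n} f → m ≤ n → ∑ m f ≤ ∑ n f
  ∑-extend {m} {n} f m≤n = ℕ.≤-trans (ℕ.m≤m+n (∑ m f) _) (ℕ.≤-reflexive
    (trans (sym (∑-append m (n ∸ m) f)) (cong (λ k → ∑ k f) (ℕ.m+[n∸m]≡n m≤n))))

  ∑-indicator-≤ : ∀ N M f → (∀ j → f j ≤ 1) → (∀ j → M ≤ j → f j ≡ 0) → ∑ N f ≤ M
  ∑-indicator-≤ N M f f≤1 f≡0 with ℕ.≤-total N M
  ... | inj₁ N≤M = begin
    ∑ N f            ≤⟨ ∑-mono N (λ j _ → f≤1 j) ⟩
    ∑ N (λ _ → 1)    ≡⟨ trans (∑-const N 1) (ℕ.*-identityʳ N) ⟩
    N                ≤⟨ N≤M ⟩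
    M                ∎
    where open ℕ.≤-Reasoning
  ... | inj₂ M≤N = begin
    ∑ N f                                         ≡⟨ cong (λ k → ∑ k f) (ℕ.m+[n∸m]≡n M≤N) ⟨
    ∑ (M + (N ∸ M)) f                             ≡⟨ ∑-append M (N ∸ M) f ⟩
    ∑ M f + ∑ (N ∸ M) (λ r → f (M + r))
      ≤⟨ ℕ.+-mono-≤ (∑-mono M (λ j _ → f≤1 j)) (∑-mono (N ∸ M) λ r _ → ℕ.≤-reflexive (f≡0 (M + r) (ℕ.m≤m+n M r))) ⟩
    ∑ M (λ _ → 1) + ∑ (N ∸ M) (λ _ → 0)           ≡⟨ cong₂ _+_ (∑-const M 1) (∑-const (N ∸ M) 0) ⟩
    M * 1 + (N ∸ M) * 0                           ≡⟨ cong₂ _+_ (ℕ.*-identityʳ M) (ℕ.*-zeroʳ (N ∸ M)) ⟩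
    M + 0                                         ≡⟨ ℕ.+-identityʳ M ⟩
    M                                             ∎
    where open ℕ.≤-Reasoning

  ∑-indicator-≥ : ∀ N M f → M ≤ N → (∀ j → j < M → 1 ≤ f j) → M ≤ ∑ N f
  ∑-indicator-≥ N M f M≤N 1≤f = begin
    M                ≡⟨ trans (∑-const M 1) (ℕ.*-identityʳ M) ⟨
    ∑ M (λ _ → 1)    ≤⟨ ∑-mono M 1≤f ⟩
    ∑ M f            ≤⟨ ∑-extend f M≤N ⟩
    ∑ N f            ∎
    where open ℕ.≤-Reasoning

  []₁≡0 : ∀ {P : Set} (P? : Dec P) → ¬ P → [ P? ]₁ ≡ 0
  []₁≡0 (yes p) ¬p = contradiction p ¬p
  []₁≡0 (no _)  ¬p = refl

  1≤[]₁ : ∀ {P : Set} (P? : Dec P) → P → 1 ≤ [ P? ]₁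
  1≤[]₁ (yes _)  p = ℕ.≤-refl
  1≤[]₁ (no ¬p) p = contradiction p ¬p

  square-cancel-≤ : ∀ m n → m * m ≤ n * n → m ≤ n
  square-cancel-≤ m n m²≤n² = ℕ.≮⇒≥ λ n<m → ℕ.<⇒≱ (ℕ.*-mono-< n<m n<m) m²≤n²

  module _ (A : ℕ → ℕ) where

    S : ℕ → ℕ
    S k = ∑ k A

    -- Column k has width `A k`, and its height is the total width of the columns j with k + j < n.
    area : ℕ → ℕ
    area n = ∑ n (λ k → A k * S (n ∸ k))

    ∑-S : ∀ n f → ∑ (S n) f ≡ ∑ n (λ k → ∑ (A k) (λ r → f (S k + r)))
    ∑-S zero    f = refl
    ∑-S (suc n) f = trans (∑-append (S n) (A n) f) (cong (_+ ∑ (A n) (λ r → f (S n + r))) (∑-S n f))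

    -- A unit square of column k above the staircase has its far corner strictly beyond the
    -- reentrant corner (S k, S (n - k)). With all of these outside the open disc, no such square is
    -- counted.
    disc⊆staircase : ∀ n N .{{_ : NonZero n}} →
      (∀ k → k < n → N * N ≤ S k * S k + S (n ∸ k) * S (n ∸ k)) → squaresInQuarterDisc N ≤ area n
    disc⊆staircase n@(suc _) N corner = begin
      -- As `S 0` is 0, the corner k = 0 says N ≤ S n: the columns reach across the disc.
      ∑ N row                                          ≤⟨ ∑-extend row (square-cancel-≤ N (S n) (corner 0 (s≤s z≤n))) ⟩
      ∑ (S n) row                                      ≡⟨ ∑-S n row ⟩
      ∑ n (λ k → ∑ (A k) (λ r → row (S k + r)))
        ≤⟨ ∑-mono n (λ k k<n → ℕ.≤-trans (∑-mono (A k) λ r _ → row≤ k r k<n)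
                                         (ℕ.≤-reflexive (∑-const (A k) (S (n ∸ k))))) ⟩
      area n                                           ∎
      where
      open ℕ.≤-Reasoning
      row : ℕ → ℕ
      row i = ∑ N (inner N i)
      row≤ : ∀ k r → k < n → row (S k + r) ≤ S (n ∸ k)
      row≤ k r k<n = ∑-indicator-≤ N (S (n ∸ k)) (inner N i)
        (λ j → []₁≤1 (suc i * suc i + suc j * suc j ℕ.≤? N * N))
        λ j M≤j → []₁≡0 (suc i * suc i + suc j * suc j ℕ.≤? N * N) (ℕ.<⇒≱ (begin-strict
          N * N                                      ≤⟨ corner k k<n ⟩
          S k * S k + S (n ∸ k) * S (n ∸ k)
            <⟨ ℕ.+-mono-< (ℕ.*-mono-< (s≤s (ℕ.m≤m+n (S k) r)) (s≤s (ℕ.m≤m+n (S k) r)))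
                          (ℕ.*-mono-< (s≤s M≤j) (s≤s M≤j)) ⟩
          suc i * suc i + suc j * suc j              ∎))
        where i = S k + r

    -- Dually, every square of column k is dominated by the protruding corner (S (k + 1), S (n -
    -- k)).
    staircase⊆disc : ∀ n N .{{_ : NonZero n}} →
      (∀ k → k < n → S (suc k) * S (suc k) + S (n ∸ k) * S (n ∸ k) ≤ N * N) → area n ≤ squaresInQuarterDisc N
    staircase⊆disc n@(suc n-1) N corner = begin
      area n
        ≤⟨ ∑-mono n (λ k k<n → ℕ.≤-trans (ℕ.≤-reflexive (sym (∑-const (A k) (S (n ∸ k)))))
                                         (∑-mono (A k) λ r r<A → row≥ k r k<n r<A)) ⟩
      ∑ n (λ k → ∑ (A k) (λ r → row (S k + r)))        ≡⟨ ∑-S n row ⟨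
      ∑ (S n) row
        ≤⟨ ∑-extend row (square-cancel-≤ (S n) N (ℕ.≤-trans (ℕ.m≤m+n _ _) (corner n-1 ℕ.≤-refl))) ⟩
      ∑ N row                                          ∎
      where
      open ℕ.≤-Reasoning
      row : ℕ → ℕ
      row i = ∑ N (inner N i)
      row≥ : ∀ k r → k < n → r < A k → S (n ∸ k) ≤ row (S k + r)
      row≥ k r k<n r<A = ∑-indicator-≥ N (S (n ∸ k)) (inner N i)
        (square-cancel-≤ (S (n ∸ k)) N (ℕ.≤-trans (ℕ.m≤n+m _ _) (corner k k<n)))
        λ j j<M → 1≤[]₁ (suc i * suc i + suc j * suc j ℕ.≤? N * N) (begin
          suc i * suc i + suc j * suc j
            ≤⟨ ℕ.+-mono-≤ (ℕ.*-mono-≤ i<S i<S) (ℕ.*-mono-≤ j<M j<M) ⟩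
          S (suc k) * S (suc k) + S (n ∸ k) * S (n ∸ k)   ≤⟨ corner k k<n ⟩
          N * N                                           ∎)
        where
        i = S k + r
        i<S : suc i ≤ S (suc k)
        i<S = ℕ.≤-trans (ℕ.≤-reflexive (sym (ℕ.+-suc (S k) r))) (ℕ.+-monoʳ-≤ (S k) r<A)

-- Wallis-type bounds for central binomial coefficients from the staircase.

-- Everything is scaled by 4 ^ n, so that the corners of the n-th staircase lie on
-- the integer grid; step n k is meaningful only for k ≤ n, and twice k
-- is 4 ^ k · s k.

module Wallis where
  open import Data.Nat.Base using (_+_; _*_; _∸_; _≤_; _<_)
  open ℕSolver.+-*-Solver
  open Staircase

  twice : ℕ → ℕ
  twice k = 2 * (k * central k)

  twice-suc : ∀ k → twice (suc k) ≡ 4 * (twice k + central k)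
  twice-suc k = trans (cong (2 *_) (central-suc k))
    (solve 2 (λ k c → con 2 :* (con 2 :* ((con 1 :+ con 2 :* k) :* c)) := con 4 :* (con 2 :* (k :* c) :+ c))
      refl k (central k))

  -- The recurrence of `twice` passes to the convolution because the extra last term carries
  -- `twice 0`, which is 0.
  conv-twice-suc : ∀ n → conv central twice (suc n) ≡ 4 * (conv central twice n + conv central central n)
  conv-twice-suc n = begin
    conv central twice (suc n)
      ≡⟨ conv-last central twice n ⟩
    conv central (twice ∘ suc) n + central (suc n) * 0
      ≡⟨ trans (cong (conv central (twice ∘ suc) n +_) (ℕ.*-zeroʳ (central (suc n)))) (ℕ.+-identityʳ _) ⟩
    conv central (twice ∘ suc) n
      ≡⟨ conv-congʳ central n twice-suc ⟩
    conv central (λ k → 4 * (twice k + central k)) n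
      ≡⟨ conv-linearʳ central 4 twice central n ⟩
    4 * (conv central twice n + conv central central n) ∎
    where open ≡-Reasoning

  -- The Leibniz rule for a square: its two halves agree by commutativity.
  conv-twice : ∀ n → n * conv central central n ≡ conv central twice n
  conv-twice n = begin
    n * conv central central n
      ≡⟨ conv-leibniz central central n ⟩
    conv w central n + conv central w n
      ≡⟨ cong (_+ conv central w n) (conv-comm w central n) ⟩
    conv central w n + conv central w n
      ≡⟨ solve 1 (λ x → x :+ x := con 1 :* (x :+ x)) refl (conv central w n) ⟩
    1 * (conv central w n + conv central w n)
      ≡⟨ conv-linearʳ central 1 w w n ⟨
    conv central (λ k → 1 * (w k + w k)) n
      ≡⟨ conv-congʳ central n (λ k → solve 1 (λ x → con 1 :* (x :+ x) := con 2 :* x) refl (w k)) ⟩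
    conv central twice n ∎
    where
    open ≡-Reasoning
    w : ℕ → ℕ
    w k = k * central k

  -- Write T for `conv central twice`. Eliminating `conv central central` from the two identities
  -- above leaves n T (n + 1) = 4 (n + 1) T n. Cancelling n needs n ≥ 1, so 1 is a base case as
  -- well.
  conv-central-twice : ∀ n → conv central twice n ≡ n * 4 ^ n
  conv-central-twice 0             = refl
  conv-central-twice 1             = refl
  conv-central-twice (suc n@(suc _)) = ℕ.*-cancelˡ-≡ _ _ n (begin
    n * conv central twice (suc n)
      ≡⟨ cong (n *_) (conv-twice-suc n) ⟩
    n * (4 * (conv central twice n + conv central central n))
      ≡⟨ solve 3 (λ n x y → n :* (con 4 :* (x :+ y)) := con 4 :* (n :* x :+ n :* y)) refl n (conv central twice n) (conv central central n) ⟩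
    4 * (n * conv central twice n + n * conv central central n)
      ≡⟨ cong (λ z → 4 * (n * conv central twice n + z)) (conv-twice n) ⟩
    4 * (n * conv central twice n + conv central twice n)
      ≡⟨ cong (λ z → 4 * (n * z + z)) (conv-central-twice n) ⟩
    4 * (n * (n * 4 ^ n) + n * 4 ^ n)
      ≡⟨ solve 2 (λ n p → con 4 :* (n :* (n :* p) :+ n :* p) := n :* ((con 1 :+ n) :* (con 4 :* p))) refl n (4 ^ n) ⟩
    n * (suc n * 4 ^ suc n) ∎)
    where open ≡-Reasoning

  module _ (n : ℕ) where
    step : ℕ → ℕ
    step k = central k * 4 ^ (n ∸ k)

    S-step : ∀ k → k ≤ n → S step k ≡ twice k * 4 ^ (n ∸ k)
    S-step zero    _   = refl
    S-step (suc k) k<n = begin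
      S step k + central k * 4 ^ (n ∸ k)
        ≡⟨ cong (_+ central k * 4 ^ (n ∸ k)) (S-step k (ℕ.<⇒≤ k<n)) ⟩
      twice k * 4 ^ (n ∸ k) + central k * 4 ^ (n ∸ k)
        ≡⟨ cong (λ m → twice k * 4 ^ m + central k * 4 ^ m) (ℕ.+-∸-assoc 1 k<n) ⟩
      twice k * (4 * 4 ^ (n ∸ suc k)) + central k * (4 * 4 ^ (n ∸ suc k))
        ≡⟨ solve 3 (λ t c p → t :* (con 4 :* p) :+ c :* (con 4 :* p) := con 4 :* (t :+ c) :* p)
             refl (twice k) (central k) (4 ^ (n ∸ suc k)) ⟩
      4 * (twice k + central k) * 4 ^ (n ∸ suc k)
        ≡⟨ cong (_* 4 ^ (n ∸ suc k)) (twice-suc k) ⟨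
      twice (suc k) * 4 ^ (n ∸ suc k) ∎
      where open ≡-Reasoning

    area-step : area step n ≡ n * (4 ^ n * 4 ^ n)
    area-step = begin
      ∑ n (λ k → step k * S step (n ∸ k))
        ≡⟨ ∑-cong n cell ⟩
      ∑ n (λ k → 4 ^ n * (central k * twice (n ∸ k)))
        ≡⟨ QuarterDisc.∑-*ˡ n (4 ^ n) (λ k → central k * twice (n ∸ k)) ⟩
      4 ^ n * ∑ n (λ k → central k * twice (n ∸ k))
        -- The convolution has one term more than the staircase has columns.
        ≡⟨ cong (4 ^ n *_) last-vanishes ⟨
      4 ^ n * ∑ (suc n) (λ k → central k * twice (n ∸ k))
        ≡⟨ cong (4 ^ n *_) (conv-∑ central twice n) ⟨
      4 ^ n * conv central twice n
        ≡⟨ cong (4 ^ n *_) (conv-central-twice n) ⟩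
      4 ^ n * (n * 4 ^ n)
        ≡⟨ solve 2 (λ n p → p :* (n :* p) := n :* (p :* p)) refl n (4 ^ n) ⟩
      n * (4 ^ n * 4 ^ n) ∎
      where
      open ≡-Reasoning
      last-vanishes : ∑ (suc n) (λ k → central k * twice (n ∸ k)) ≡ ∑ n (λ k → central k * twice (n ∸ k))
      last-vanishes = trans (cong (λ m → ∑ n (λ k → central k * twice (n ∸ k)) + central n * twice m) (ℕ.n∸n≡0 n))
        (trans (cong (∑ n (λ k → central k * twice (n ∸ k)) +_) (ℕ.*-zeroʳ (central n))) (ℕ.+-identityʳ _))
      cell : ∀ k → k < n → step k * S step (n ∸ k) ≡ 4 ^ n * (central k * twice (n ∸ k))
      cell k k<n = begin
        central k * 4 ^ (n ∸ k) * S step (n ∸ k)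
          ≡⟨ cong (central k * 4 ^ (n ∸ k) *_) (S-step (n ∸ k) (ℕ.m∸n≤m n k)) ⟩
        central k * 4 ^ (n ∸ k) * (twice (n ∸ k) * 4 ^ (n ∸ (n ∸ k)))
          ≡⟨ solve 4 (λ c p t q → c :* p :* (t :* q) := p :* q :* (c :* t))
               refl (central k) (4 ^ (n ∸ k)) (twice (n ∸ k)) (4 ^ (n ∸ (n ∸ k))) ⟩
        4 ^ (n ∸ k) * 4 ^ (n ∸ (n ∸ k)) * (central k * twice (n ∸ k))
          ≡⟨ cong (_* (central k * twice (n ∸ k))) (ℕ.^-distribˡ-+-* 4 (n ∸ k) (n ∸ (n ∸ k))) ⟨
        4 ^ (n ∸ k + (n ∸ (n ∸ k))) * (central k * twice (n ∸ k))
          ≡⟨ cong (λ m → 4 ^ m * (central k * twice (n ∸ k))) (ℕ.m+[n∸m]≡n (ℕ.m∸n≤m n k)) ⟩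
        4 ^ n * (central k * twice (n ∸ k)) ∎

  -- This says that k (a k)² increases: after multiplication by k + 1 it is 16 k (k + 1) ≤ 4 (2 k +
  -- 1)², times `c * c`.
  growth-suc : ∀ k → 16 * (k * (central k * central k)) ≤ suc k * (central (suc k) * central (suc k))
  growth-suc k = ℕ.*-cancelˡ-≤ (suc k) (begin
    suc k * (16 * (k * (c * c)))
      ≤⟨ ℕ.m≤m+n _ (4 * (c * c)) ⟩
    suc k * (16 * (k * (c * c))) + 4 * (c * c)
      ≡⟨ solve 2 (λ k c → (con 1 :+ k) :* (con 16 :* (k :* (c :* c))) :+ con 4 :* (c :* c)
           := (con 2 :* ((con 1 :+ con 2 :* k) :* c)) :* (con 2 :* ((con 1 :+ con 2 :* k) :* c))) refl k c ⟩
    (2 * (suc (2 * k) * c)) * (2 * (suc (2 * k) * c))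
      ≡⟨ cong₂ _*_ (central-suc k) (central-suc k) ⟨
    (suc k * c′) * (suc k * c′)
      ≡⟨ solve 2 (λ k c → (k :* c) :* (k :* c) := k :* (k :* (c :* c))) refl (suc k) c′ ⟩
    suc k * (suc k * (c′ * c′)) ∎)
    where
    open ℕ.≤-Reasoning
    c  = central k
    c′ = central (suc k)

  growth : ∀ d k → k * (central k * central k) * (4 ^ d * 4 ^ d) ≤ (d + k) * (central (d + k) * central (d + k))
  growth zero    k = ℕ.≤-reflexive (ℕ.*-identityʳ _)
  growth (suc d) k = begin
    x * (4 * p * (4 * p))                       ≡⟨ solve 2 (λ x p → x :* (con 4 :* p :* (con 4 :* p)) := con 16 :* (x :* (p :* p))) refl x p ⟩
    16 * (x * (p * p))                          ≤⟨ ℕ.*-monoʳ-≤ 16 (growth d k) ⟩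
    16 * (m * (central m * central m))          ≤⟨ growth-suc m ⟩
    suc m * (central (suc m) * central (suc m)) ∎
    where
    open ℕ.≤-Reasoning
    x = k * (central k * central k)
    p = 4 ^ d
    m = d + k

  S-≤ : ∀ n k → k ≤ n → n * (S (step n) k * S (step n) k) ≤ k * (twice n * twice n)
  S-≤ n k k≤n = begin
    n * (S (step n) k * S (step n) k)
      ≡⟨ cong (λ s → n * (s * s)) (S-step n k k≤n) ⟩
    n * (2 * (k * c) * p * (2 * (k * c) * p))
      ≡⟨ solve 4 (λ n k c p → n :* (con 2 :* (k :* c) :* p :* (con 2 :* (k :* c) :* p))
                            := con 4 :* n :* k :* (k :* (c :* c) :* (p :* p))) refl n k c p ⟩
    4 * n * k * (k * (c * c) * (p * p))
      ≤⟨ ℕ.*-monoʳ-≤ (4 * n * k) (subst (λ m → k * (c * c) * (p * p) ≤ m * (central m * central m))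
           (ℕ.m∸n+n≡m k≤n) (growth (n ∸ k) k)) ⟩
    4 * n * k * (n * (central n * central n))
      ≡⟨ solve 3 (λ n k c → con 4 :* n :* k :* (n :* (c :* c)) := k :* (con 2 :* (n :* c) :* (con 2 :* (n :* c))))
           refl n k (central n) ⟩
    k * (twice n * twice n) ∎
    where
    open ℕ.≤-Reasoning
    c = central k
    p = 4 ^ (n ∸ k)

  -- This says that (s m)² / (2 m - 1) decreases, which comes down to (2 m - 1)(2 m + 1) ≤ 4 m².
  shrink-suc : ∀ k → let m = suc k in
    suc (2 * k) * (twice (suc m) * twice (suc m)) ≤ 16 * (suc (2 * m) * (twice m * twice m))
  shrink-suc k = begin
    suc (2 * k) * (twice (suc m) * twice (suc m))
      ≡⟨ cong (λ t → suc (2 * k) * (2 * t * (2 * t))) (central-suc m) ⟩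
    suc (2 * k) * (2 * (2 * (suc (2 * m) * c)) * (2 * (2 * (suc (2 * m) * c))))
      ≤⟨ ℕ.m≤m+n _ (16 * (suc (2 * m) * (c * c))) ⟩
    suc (2 * k) * (2 * (2 * (suc (2 * m) * c)) * (2 * (2 * (suc (2 * m) * c)))) + 16 * (suc (2 * m) * (c * c))
      ≡⟨ solve 2 (λ k c → let m = con 1 :+ k ; s = con 1 :+ con 2 :* m in
           (con 1 :+ con 2 :* k) :* (con 2 :* (con 2 :* (s :* c)) :* (con 2 :* (con 2 :* (s :* c)))) :+ con 16 :* (s :* (c :* c))
           := con 16 :* (s :* (con 2 :* (m :* c) :* (con 2 :* (m :* c))))) refl k c ⟩
    16 * (suc (2 * m) * (twice m * twice m)) ∎
    where
    open ℕ.≤-Reasoning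
    m = suc k
    c = central m

  shrink : ∀ d k → let n = suc (d + k) in
    suc (2 * k) * (twice n * twice n) ≤ suc (2 * (d + k)) * (twice (suc k) * 4 ^ d * (twice (suc k) * 4 ^ d))
  shrink zero    k = ℕ.≤-reflexive (cong (λ t → suc (2 * k) * (t * t)) (sym (ℕ.*-identityʳ (twice (suc k)))))
  shrink (suc d) k = ℕ.*-cancelˡ-≤ s (begin
    s * (r * (t″ * t″))
      ≡⟨ solve 3 (λ s r t → s :* (r :* t) := r :* (s :* t)) refl s r (t″ * t″) ⟩
    r * (s * (t″ * t″))
      ≤⟨ ℕ.*-monoʳ-≤ r (shrink-suc (d + k)) ⟩
    r * (16 * (s′ * (t′ * t′)))
      ≡⟨ solve 3 (λ r s t → r :* (con 16 :* (s :* t)) := con 16 :* s :* (r :* t)) refl r s′ (t′ * t′) ⟩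
    16 * s′ * (r * (t′ * t′))
      ≤⟨ ℕ.*-monoʳ-≤ (16 * s′) (shrink d k) ⟩
    16 * s′ * (s * (t * p * (t * p)))
      ≡⟨ solve 4 (λ s′ s t p → con 16 :* s′ :* (s :* (t :* p :* (t :* p))) := s :* (s′ :* (t :* (con 4 :* p) :* (t :* (con 4 :* p)))))
           refl s′ s t p ⟩
    s * (s′ * (t * (4 * p) * (t * (4 * p)))) ∎)
    where
    open ℕ.≤-Reasoning
    s  = suc (2 * (d + k))
    s′ = suc (2 * suc (d + k))
    r  = suc (2 * k)
    t  = twice (suc k)
    t′ = twice (suc (d + k))
    t″ = twice (suc (suc (d + k)))
    p  = 4 ^ d

  S-≥ : ∀ m k → k ≤ m → let n = suc m in
    suc (2 * k) * (twice n * twice n) ≤ suc (2 * m) * (S (step n) (suc k) * S (step n) (suc k))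
  S-≥ m k k≤m = begin
    suc (2 * k) * (twice n * twice n)
      ≤⟨ subst (λ l → suc (2 * k) * (twice (suc l) * twice (suc l)) ≤ suc (2 * l) * (s * s))
           (ℕ.m∸n+n≡m k≤m) (shrink (m ∸ k) k) ⟩
    suc (2 * m) * (s * s)
      ≡⟨ cong (λ s → suc (2 * m) * (s * s)) (S-step n (suc k) (s≤s k≤m)) ⟨
    suc (2 * m) * (S (step n) (suc k) * S (step n) (suc k)) ∎
    where
    open ℕ.≤-Reasoning
    n = suc m
    s = twice (suc k) * 4 ^ (m ∸ k)

  -- By `S-≤`, a protruding corner has squared distance at most (n + 1) / n times `twice n` squared.
  -- This is 4 n (n + 1) c² = (2 n + 1)² c² - c² with c = `central n`, whence the radius.
  quarterDisc-≥ : ∀ n .{{_ : NonZero n}} → n * (4 ^ n * 4 ^ n) ≤ squaresInQuarterDisc (suc (2 * n) * central n)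
  quarterDisc-≥ n@(suc _) = subst (_≤ squaresInQuarterDisc N) (area-step n) (staircase⊆disc (step n) n N corner)
    where
    open ℕ.≤-Reasoning
    N = suc (2 * n) * central n
    corner : ∀ k → k < n → S (step n) (suc k) * S (step n) (suc k) + S (step n) (n ∸ k) * S (step n) (n ∸ k) ≤ N * N
    corner k k<n = ℕ.*-cancelˡ-≤ n (begin
      n * (S (step n) (suc k) * S (step n) (suc k) + S (step n) (n ∸ k) * S (step n) (n ∸ k))
        ≡⟨ ℕ.*-distribˡ-+ n (S (step n) (suc k) * S (step n) (suc k)) _ ⟩
      n * (S (step n) (suc k) * S (step n) (suc k)) + n * (S (step n) (n ∸ k) * S (step n) (n ∸ k))
        ≤⟨ ℕ.+-mono-≤ (S-≤ n (suc k) k<n) (S-≤ n (n ∸ k) (ℕ.m∸n≤m n k)) ⟩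
      suc k * (twice n * twice n) + (n ∸ k) * (twice n * twice n)
        ≡⟨ ℕ.*-distribʳ-+ (twice n * twice n) (suc k) (n ∸ k) ⟨
      (suc k + (n ∸ k)) * (twice n * twice n)
        ≡⟨ cong (λ m → suc m * (twice n * twice n)) (ℕ.m+[n∸m]≡n (ℕ.<⇒≤ k<n)) ⟩
      suc n * (twice n * twice n)
        ≤⟨ ℕ.m≤m+n _ (n * (central n * central n)) ⟩
      suc n * (twice n * twice n) + n * (central n * central n)
        ≡⟨ solve 2 (λ n c → (con 1 :+ n) :* (con 2 :* (n :* c) :* (con 2 :* (n :* c))) :+ n :* (c :* c)
             := n :* ((con 1 :+ con 2 :* n) :* c :* ((con 1 :+ con 2 :* n) :* c))) refl n (central n) ⟩
      n * (N * N) ∎)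

  -- By `S-≥`, a reentrant corner with k ≥ 1 has squared distance at least 2 m / (2 m + 1) times
  -- `twice n` squared. The radius fits because (2 m + 1)³ ≤ 8 m (m + 1)² for m ≥ 1.
  quarterDisc-≤ : ∀ m .{{_ : NonZero m}} → let n = suc m in
    squaresInQuarterDisc (suc (2 * m) * central n) ≤ n * (4 ^ n * 4 ^ n)
  quarterDisc-≤ m@(suc l) = subst (squaresInQuarterDisc N ≤_) (area-step n) (disc⊆staircase (step n) n N corner)
    where
    open ℕ.≤-Reasoning
    n = suc m
    N = suc (2 * m) * central n
    t = twice n
    corner : ∀ k → k < n → N * N ≤ S (step n) k * S (step n) k + S (step n) (n ∸ k) * S (step n) (n ∸ k)
    corner zero    _   = subst (λ s → N * N ≤ s * s) (sym S-n) (ℕ.*-mono-≤ N≤t N≤t)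
      where
      S-n : S (step n) n ≡ t
      S-n = trans (S-step n n ℕ.≤-refl) (trans (cong (λ d → t * 4 ^ d) (ℕ.n∸n≡0 n)) (ℕ.*-identityʳ t))
      N≤t : N ≤ t
      N≤t = ℕ.≤-trans (ℕ.m≤m+n N (central n)) (ℕ.≤-reflexive
        (solve 2 (λ m c → (con 1 :+ con 2 :* m) :* c :+ c := con 2 :* ((con 1 :+ m) :* c)) refl m (central n)))
    corner (suc k) (s≤s k<m) = ℕ.*-cancelˡ-≤ (suc (2 * m)) (begin
      suc (2 * m) * (N * N)
        -- The coefficient is 8 m (m + 1)² - (2 m + 1)³ = 4 m² + 2 m - 1 at m = l + 1.
        ≤⟨ ℕ.m≤m+n _ ((4 * (l * l) + 10 * l + 5) * (central n * central n)) ⟩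
      suc (2 * m) * (N * N) + (4 * (l * l) + 10 * l + 5) * (central n * central n)
        ≡⟨ solve 2 (λ l c → let m = con 1 :+ l ; s = con 1 :+ con 2 :* m ; t = con 2 :* ((con 1 :+ m) :* c) in
             s :* (s :* c :* (s :* c)) :+ (con 4 :* (l :* l) :+ con 10 :* l :+ con 5) :* (c :* c)
             := con 2 :* m :* (t :* t)) refl l (central n) ⟩
      2 * m * (t * t)
        ≡⟨ cong (λ i → 2 * i * (t * t)) (ℕ.m+[n∸m]≡n k<m) ⟨
      2 * (suc k + j) * (t * t)
        ≡⟨ solve 3 (λ k j x → con 2 :* (con 1 :+ k :+ j) :* x := (con 1 :+ con 2 :* k) :* x :+ (con 1 :+ con 2 :* j) :* x)
             refl k j (t * t) ⟩
      suc (2 * k) * (t * t) + suc (2 * j) * (t * t)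
        ≤⟨ ℕ.+-mono-≤ (S-≥ m k (ℕ.<⇒≤ k<m)) (S-≥ m j (ℕ.m∸n≤m m (suc k))) ⟩
      suc (2 * m) * (S (step n) (suc k) * S (step n) (suc k)) + suc (2 * m) * (S (step n) (suc j) * S (step n) (suc j))
        ≡⟨ ℕ.*-distribˡ-+ (suc (2 * m)) (S (step n) (suc k) * S (step n) (suc k)) _ ⟨
      suc (2 * m) * (S (step n) (suc k) * S (step n) (suc k) + S (step n) (suc j) * S (step n) (suc j))
        ≡⟨ cong (λ i → suc (2 * m) * (S (step n) (suc k) * S (step n) (suc k) + S (step n) i * S (step n) i))
             (ℕ.+-∸-assoc 1 k<m) ⟨
      suc (2 * m) * (S (step n) (suc k) * S (step n) (suc k) + S (step n) (n ∸ suc k) * S (step n) (n ∸ suc k)) ∎)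
      where j = m ∸ suc k

  0<odd*central : ∀ m n → NonZero (suc (2 * m) * central n)
  0<odd*central m n = ℕ.>-nonZero (ℕ.*-mono-≤ (s≤s (z≤n {2 * m})) (paths-pos n n))

  n≤4^n : ∀ n → n ≤ 4 ^ n
  n≤4^n zero    = z≤n
  n≤4^n (suc n) = begin
    1 + n            ≤⟨ ℕ.+-mono-≤ (ℕ.m^n>0 4 n) (n≤4^n n) ⟩
    4 ^ n + 4 ^ n    ≤⟨ ℕ.m≤m+n _ (2 * 4 ^ n) ⟩
    4 ^ n + 4 ^ n + 2 * 4 ^ n  ≡⟨ solve 1 (λ p → p :+ p :+ con 2 :* p := con 4 :* p) refl (4 ^ n) ⟩
    4 * 4 ^ n        ∎
    where open ℕ.≤-Reasoning

  -- Dividing by n M², this is (c n)² π n ≤ (1 + 11/n) 16ⁿ with π replaced by its approximation at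
  -- mesh 1/M. The grid loss is 2 K, absorbed through n c ≤ 16ⁿ, so M may be arbitrary.
  central-disc-≤ : ∀ m M .{{_ : NonZero m}} .{{_ : NonZero M}} → let n = suc m in
    n * n * (central n * central n) * (4 * squaresInQuarterDisc M) ≤ (n + 11) * (4 ^ n * 4 ^ n) * (M * M)
  central-disc-≤ m M = ℕ.*-cancelˡ-≤ (s * s) (begin
    s * s * (n * n * (c * c) * (4 * q))
      ≡⟨ solve 4 (λ s n c q → s :* s :* (n :* n :* (c :* c) :* (con 4 :* q))
                            := con 4 :* (n :* n) :* (s :* c :* (s :* c) :* q)) refl s n c q ⟩
    4 * (n * n) * (K * K * q)
      ≤⟨ ℕ.*-monoʳ-≤ (4 * (n * n)) (ℕ.≤-trans (QuarterDisc.compare M K {{0<odd*central m n}})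
           (ℕ.*-monoʳ-≤ (M * M) (ℕ.+-monoˡ-≤ (2 * K) (quarterDisc-≤ m)))) ⟩
    4 * (n * n) * (M * M * (n * (p * p) + 2 * K))
      ≡⟨ solve 5 (λ n M p s c → con 4 :* (n :* n) :* (M :* M :* (n :* (p :* p) :+ con 2 :* (s :* c)))
                            := con 4 :* (n :* n) :* n :* (p :* p) :* (M :* M) :+ con 8 :* n :* s :* (M :* M) :* (n :* c))
           refl n M p s c ⟩
    4 * (n * n) * n * (p * p) * (M * M) + 8 * n * s * (M * M) * (n * c)
      ≤⟨ ℕ.+-monoʳ-≤ (4 * (n * n) * n * (p * p) * (M * M))
           (ℕ.*-monoʳ-≤ (8 * n * s * (M * M)) (ℕ.*-mono-≤ (n≤4^n n) (central≤4^ n))) ⟩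
    4 * (n * n) * n * (p * p) * (M * M) + 8 * n * s * (M * M) * (p * p)
      -- The constant 11 makes s² (n + 11) - 4 n³ - 8 n s = 24 m² + 13 m, with no negative
      -- coefficient.
      ≤⟨ ℕ.m≤m+n _ ((24 * (m * m) + 13 * m) * (p * p) * (M * M)) ⟩
    4 * (n * n) * n * (p * p) * (M * M) + 8 * n * s * (M * M) * (p * p) + (24 * (m * m) + 13 * m) * (p * p) * (M * M)
      ≡⟨ solve 3 (λ m W M² → let n = con 1 :+ m ; s = con 1 :+ con 2 :* m in
           con 4 :* (n :* n) :* n :* W :* M² :+ con 8 :* n :* s :* M² :* W
             :+ (con 24 :* (m :* m) :+ con 13 :* m) :* W :* M²
           := s :* s :* ((n :+ con 11) :* W :* M²)) refl m (p * p) (M * M) ⟩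
    s * s * ((n + 11) * (p * p) * (M * M)) ∎)
    where
    open ℕ.≤-Reasoning
    n = suc m
    s = suc (2 * m)
    c = central n
    p = 4 ^ n
    q = squaresInQuarterDisc M
    K = s * c

  -- Now the grid loss is 2 M, which is relatively small only for large M. The slack 2 is 1 for this
  -- loss and 1 for replacing (2 n + 1)² by 4 n².
  central-disc-≥ : ∀ n M .{{_ : NonZero n}} .{{_ : NonZero M}} → 8 * (n * n) ≤ M →
    n * (4 ^ n * 4 ^ n) * (M * M)
      ≤ n * n * (central n * central n) * (4 * squaresInQuarterDisc M) + 2 * (4 ^ n * 4 ^ n) * (M * M)
  central-disc-≥ n M 8n²≤M = ℕ.*-cancelˡ-≤ (s * s) (begin
    s * s * (n * W * (M * M))
      ≤⟨ ℕ.m≤m+n _ ((3 * n + 1) * W * (M * M)) ⟩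
    s * s * (n * W * (M * M)) + (3 * n + 1) * W * (M * M)
      ≡⟨ solve 3 (λ n W M² → let s = con 1 :+ con 2 :* n in
           s :* s :* (n :* W :* M²) :+ (con 3 :* n :+ con 1) :* W :* M²
           := con 4 :* (n :* n) :* (M² :* (n :* W)) :+ s :* s :* W :* M²) refl n W (M * M) ⟩
    4 * (n * n) * (M * M * (n * W)) + s * s * W * (M * M)
      ≤⟨ ℕ.+-monoˡ-≤ (s * s * W * (M * M)) (ℕ.*-monoʳ-≤ (4 * (n * n))
           (ℕ.≤-trans (ℕ.*-monoʳ-≤ (M * M) (quarterDisc-≥ n)) (QuarterDisc.compare K M))) ⟩
    4 * (n * n) * (K * K * (q + 2 * M)) + s * s * W * (M * M)
      ≡⟨ solve 6 (λ n s c q M W →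
           con 4 :* (n :* n) :* (s :* c :* (s :* c) :* (q :+ con 2 :* M)) :+ s :* s :* W :* (M :* M)
           := s :* s :* (n :* n :* (c :* c) :* (con 4 :* q)) :+ s :* s :* (c :* c) :* M :* (con 8 :* (n :* n))
              :+ s :* s :* W :* (M :* M))
           refl n s c q M W ⟩
    s * s * (n * n * (c * c) * (4 * q)) + s * s * (c * c) * M * (8 * (n * n)) + s * s * W * (M * M)
      ≤⟨ ℕ.+-monoˡ-≤ (s * s * W * (M * M)) (ℕ.+-monoʳ-≤ (s * s * (n * n * (c * c) * (4 * q)))
           (ℕ.*-mono-≤ (ℕ.*-monoˡ-≤ M (ℕ.*-monoʳ-≤ (s * s) (ℕ.*-mono-≤ (central≤4^ n) (central≤4^ n)))) 8n²≤M)) ⟩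
    s * s * (n * n * (c * c) * (4 * q)) + s * s * W * M * M + s * s * W * (M * M)
      ≡⟨ solve 4 (λ s x W M → s :* s :* x :+ s :* s :* W :* M :* M :+ s :* s :* W :* (M :* M)
                            := s :* s :* (x :+ con 2 :* W :* (M :* M)))
           refl s (n * n * (c * c) * (4 * q)) W M ⟩
    s * s * (n * n * (c * c) * (4 * q) + 2 * W * (M * M)) ∎)
    where
    open ℕ.≤-Reasoning
    s = suc (2 * n)
    c = central n
    W = 4 ^ n * 4 ^ n
    q = squaresInQuarterDisc M
    K = s * c

open Wallis using (central-disc-≤; central-disc-≥)

-- From counts to inequalities between rationals.

module RationalEstimates where
  open import Data.Rational.Base using (_+_; _*_; -_; _-_; _≤_; _<_; positive; nonNegative)
  open RationalLemmas
  open ℚSolver.+-*-Solver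

  ι : ℕ → ℚ
  ι n = frac n 1

  opaque
    unfolding frac

    -- As `frac` is opaque, the ring solver can relate `ι 3` and `ι 5` only after they are rewritten
    -- as sums of ones.
    ι-3 : ι 3 ≡ 1ℚ + 1ℚ + 1ℚ
    ι-3 = refl

    ι-5 : ι 5 ≡ 1ℚ + 1ℚ + 1ℚ + 1ℚ + 1ℚ
    ι-5 = refl

  ι-* : ∀ a b → ι (a ℕ.* b) ≡ ι a * ι b
  ι-* a b = sym (frac-* a 1 b 1)

  ι-+ : ∀ a b → ι (a ℕ.+ b) ≡ ι a + ι b
  ι-+ a b = trans (cong₂ (λ x y → ι (x ℕ.+ y)) (sym (ℕ.*-identityʳ a)) (sym (ℕ.*-identityʳ b)))
    (sym (frac-+ a 1 b 1))

  ι-mono : ∀ {a b} → a ℕ.≤ b → ι a ≤ ι b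
  ι-mono {a} {b} a≤b = frac-≤ a 1 b 1 (ℕ.*-monoˡ-≤ 1 a≤b)

  0≤ι : ∀ n → 0ℚ ≤ ι n
  0≤ι n = 0≤frac n 1

  0<ι : ∀ n .{{_ : NonZero n}} → 0ℚ < ι n
  0<ι n = 0<frac n 1

  frac-cancel : ∀ a b .{{_ : NonZero b}} → frac a b * ι b ≡ ι a
  frac-cancel a b@(suc _) = trans (frac-* a b b 1)
    (ℚ.≤-antisym (frac-≤ (a ℕ.* b) (b ℕ.* 1) a 1 (ℕ.≤-reflexive (ℕ.*-assoc a b 1)))
                 (frac-≤ a 1 (a ℕ.* b) (b ℕ.* 1) (ℕ.≤-reflexive (sym (ℕ.*-assoc a b 1)))))

  *-nonNeg : ∀ {p q} → 0ℚ ≤ p → 0ℚ ≤ q → 0ℚ ≤ p * q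
  *-nonNeg {p} {q} 0≤p 0≤q = *-mono {0ℚ} {p} {0ℚ} {q} ℚ.≤-refl 0≤q 0≤p 0≤q

  *-monoʳ : ∀ {p q} r → 0ℚ ≤ r → p ≤ q → r * p ≤ r * q
  *-monoʳ r 0≤r = ℚ.*-monoˡ-≤-nonNeg r {{nonNegative 0≤r}}

  *-monoˡ : ∀ {p q} r → 0ℚ ≤ r → p ≤ q → p * r ≤ q * r
  *-monoˡ r 0≤r = ℚ.*-monoʳ-≤-nonNeg r {{nonNegative 0≤r}}

  cancelˡ : ∀ {p q} r → 0ℚ < r → r * p ≤ r * q → p ≤ q
  cancelˡ r 0<r = ℚ.*-cancelˡ-≤-pos r {{positive 0<r}}

  cancelʳ : ∀ {p q} r → 0ℚ < r → p * r ≤ q * r → p ≤ q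
  cancelʳ r 0<r = ℚ.*-cancelʳ-≤-pos r {{positive 0<r}}

  square-cancel : ∀ {p q} → 0ℚ ≤ q → p * p ≤ q * q → p ≤ q
  square-cancel {p} {q} 0≤q p²≤q² with p ℚ.≤? q
  ... | yes p≤q = p≤q
  ... | no ¬p≤q = contradiction (ℚ.≤-<-trans p²≤q² (begin-strict
    q * q    ≤⟨ *-monoʳ q 0≤q (ℚ.<⇒≤ q<p) ⟩
    q * p    <⟨ ℚ.*-monoˡ-<-pos p {{positive (ℚ.≤-<-trans 0≤q q<p)}} q<p ⟩
    p * p    ∎)) (ℚ.<-irrefl refl)
    where
    open ℚ.≤-Reasoning
    q<p = ℚ.≰⇒> ¬p≤q

  -- In the absence of a square root on ℚ, J stands for √(w / n).

  sqrt-separation : ∀ {n x w a b J κ} → 0ℚ ≤ x → 0ℚ ≤ w → 0ℚ ≤ a → 0ℚ ≤ J → 0ℚ ≤ κ →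
    n ≤ x + x → w ≤ a * a * x + a * a * x → w ≤ J * J * n → b * b * x < a * a * x + κ * w → b ≤ a + κ * J
  sqrt-separation {n} {x} {w} {a} {b} {J} {κ} 0≤x 0≤w 0≤a 0≤J 0≤κ n≤2x w≤a w≤J b²<
    with b ℚ.≤? a + κ * J
  ... | yes b≤ = b≤
  ... | no ¬b≤ = contradiction (ℚ.<-≤-trans b²< (begin
    a * a * x + κ * w
      ≤⟨ ℚ.+-monoʳ-≤ (a * a * x) (*-monoʳ κ 0≤κ w≤2aJx) ⟩
    a * a * x + κ * (2aJx)
      ≤⟨ p≤p+q _ (*-nonNeg (*-nonNeg 0≤κJ 0≤κJ) 0≤x) ⟩
    a * a * x + κ * (2aJx) + κ * J * (κ * J) * x
      ≡⟨ solve 4 (λ a x k j → a :* a :* x :+ k :* (a :* j :* x :+ a :* j :* x) :+ k :* j :* (k :* j) :* x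
           := (a :+ k :* j) :* (a :+ k :* j) :* x) refl a x κ J ⟩
    (a + κ * J) * (a + κ * J) * x
      ≤⟨ *-monoˡ x 0≤x (*-mono (+-nonNeg 0≤a 0≤κJ) (ℚ.≤-trans (+-nonNeg 0≤a 0≤κJ) ≤b) ≤b ≤b) ⟩
    b * b * x ∎)) (ℚ.<-irrefl refl)
    where
    open ℚ.≤-Reasoning
    2aJx = a * J * x + a * J * x
    ≤b : a + κ * J ≤ b
    ≤b = ℚ.<⇒≤ (ℚ.≰⇒> ¬b≤)
    0≤κJ : 0ℚ ≤ κ * J
    0≤κJ = *-nonNeg 0≤κ 0≤J
    0≤aJx : 0ℚ ≤ a * J * x
    0≤aJx = *-nonNeg (*-nonNeg 0≤a 0≤J) 0≤x
    -- Multiplying w ≤ 2 a² x by w ≤ 2 J² x bounds w². This turns κ w into the cross term of (a + κ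
    -- J)² x.
    w≤2aJx : w ≤ 2aJx
    w≤2aJx = square-cancel (+-nonNeg 0≤aJx 0≤aJx) (begin
      w * w
        ≤⟨ *-mono 0≤w (*-nonNeg (*-nonNeg 0≤J 0≤J) (+-nonNeg 0≤x 0≤x)) w≤a
             (ℚ.≤-trans w≤J (*-monoʳ (J * J) (*-nonNeg 0≤J 0≤J) n≤2x)) ⟩
      (a * a * x + a * a * x) * (J * J * (x + x))
        ≡⟨ solve 3 (λ a x j → (a :* a :* x :+ a :* a :* x) :* (j :* j :* (x :+ x))
             := (a :* j :* x :+ a :* j :* x) :* (a :* j :* x :+ a :* j :* x)) refl a x J ⟩
      2aJx * 2aJx ∎)

  -- V stands for 4ⁿ / √(π n), J for 4ⁿ / √n, and x for π n.

  diagonal-estimate : ∀ {n x w c V J B κ η k} → 0ℚ < n → 0ℚ < x → 0ℚ < w → 0ℚ ≤ c → 0ℚ ≤ V → 0ℚ ≤ J →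
    0ℚ < η → η + η + η ≤ κ → η + η ≤ 1ℚ → k ≤ κ * n → n ≤ x + x → w ≤ J * J * n →
    c * c * x ≤ w + η * w → w ≤ c * c * x + η * w →
    w ≤ V * V * x → V * V * x ≤ w + η * w →
    n * B ≤ ι 3 * (n * c) + k * c → ι 3 * (n * c) ≤ n * B + k * c →
    B ≤ ι 3 * V + ι 5 * κ * J × ι 3 * V ≤ B + ι 5 * κ * J
  diagonal-estimate {n} {x} {w} {c} {V} {J} {B} {κ} {η} {k}
    0<n 0<x 0<w 0≤c 0≤V 0≤J 0<η 3η≤κ 2η≤1 k≤κn n≤2x w≤J²n c²x≤ c²x≥ V²x≥ V²x≤ B≤ B≥ = upper , lower
    where
    open ℚ.≤-Reasoning
    0≤x = ℚ.<⇒≤ 0<x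
    0≤w = ℚ.<⇒≤ 0<w
    0<ηw : 0ℚ < η * w
    0<ηw = *-pos 0<η 0<w
    0≤ηw = ℚ.<⇒≤ 0<ηw
    0≤η = ℚ.<⇒≤ 0<η
    0≤κ : 0ℚ ≤ κ
    0≤κ = ℚ.≤-trans (+-nonNeg (+-nonNeg 0≤η 0≤η) 0≤η) 3η≤κ
    -- Two η come from the two approximations of w; the third makes the inequality strict, as
    -- `sqrt-separation` demands.
    2ηw<κw : η * w + η * w < κ * w
    2ηw<κw = begin-strict
      η * w + η * w              ≡⟨ ℚ.+-identityʳ _ ⟨
      η * w + η * w + 0ℚ         <⟨ ℚ.+-monoʳ-< (η * w + η * w) 0<ηw ⟩
      η * w + η * w + η * w      ≡⟨ solve 2 (λ e w → e :* w :+ e :* w :+ e :* w := (e :+ e :+ e) :* w) refl η w ⟩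
      (η + η + η) * w            ≤⟨ *-monoˡ w 0≤w 3η≤κ ⟩
      κ * w                      ∎
    close : ∀ {p q} → p ≤ w + η * w → w ≤ q + η * w → p < q + κ * w
    close {p} {q} p≤ w≤ = begin-strict
      p                          ≤⟨ p≤ ⟩
      w + η * w                  ≤⟨ ℚ.+-monoˡ-≤ (η * w) w≤ ⟩
      q + η * w + η * w          ≡⟨ ℚ.+-assoc q _ _ ⟩
      q + (η * w + η * w)        <⟨ ℚ.+-monoʳ-< q 2ηw<κw ⟩
      q + κ * w                  ∎
    w≤2c²x : w ≤ c * c * x + c * c * x
    w≤2c²x = ℚ.≤-trans (ℚ.≤-reflexive (solve 1 (λ w → w := w :+ w :- w) refl w)) (≤+⇒-≤ (w + w) w (begin
      w + w                                          ≤⟨ ℚ.+-mono-≤ c²x≥ c²x≥ ⟩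
      c * c * x + η * w + (c * c * x + η * w)
        ≡⟨ solve 3 (λ y e w → y :+ e :* w :+ (y :+ e :* w) := (e :+ e) :* w :+ (y :+ y)) refl (c * c * x) η w ⟩
      (η + η) * w + (c * c * x + c * c * x)          ≤⟨ ℚ.+-monoˡ-≤ _ (*-monoˡ w 0≤w 2η≤1) ⟩
      1ℚ * w + (c * c * x + c * c * x)               ≡⟨ cong (_+ _) (ℚ.*-identityˡ w) ⟩
      w + (c * c * x + c * c * x)                    ∎))
    c≤V : c ≤ V + κ * J
    c≤V = sqrt-separation 0≤x 0≤w 0≤V 0≤J 0≤κ n≤2x
      (ℚ.≤-trans V²x≥ (p≤p+q _ (ℚ.≤-trans 0≤w V²x≥))) w≤J²n
      (close {c * c * x} {V * V * x} c²x≤ (ℚ.≤-trans V²x≥ (p≤p+q _ 0≤ηw)))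
    V≤c : V ≤ c + κ * J
    V≤c = sqrt-separation 0≤x 0≤w 0≤c 0≤J 0≤κ n≤2x w≤2c²x w≤J²n (close {V * V * x} {c * c * x} V²x≤ c²x≥)
    c≤2J : c ≤ J + J
    c≤2J = square-cancel (+-nonNeg 0≤J 0≤J) (cancelʳ x 0<x (begin
      c * c * x                  ≤⟨ c²x≤ ⟩
      w + η * w                  ≤⟨ ℚ.+-monoʳ-≤ w (*-monoˡ w 0≤w (ℚ.≤-trans (p≤p+q η 0≤η) 2η≤1)) ⟩
      w + 1ℚ * w                 ≡⟨ cong (w +_) (ℚ.*-identityˡ w) ⟩
      w + w                      ≤⟨ ℚ.+-mono-≤ w≤2J²x w≤2J²x ⟩
      J * J * (x + x) + J * J * (x + x)
        ≡⟨ solve 2 (λ j x → j :* j :* (x :+ x) :+ j :* j :* (x :+ x) := (j :+ j) :* (j :+ j) :* x) refl J x ⟩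
      (J + J) * (J + J) * x      ∎))
      where
      w≤2J²x : w ≤ J * J * (x + x)
      w≤2J²x = ℚ.≤-trans w≤J²n (*-monoʳ (J * J) (*-nonNeg 0≤J 0≤J) n≤2x)
    κc≤ : κ * c ≤ κ * (J + J)
    κc≤ = *-monoʳ κ 0≤κ c≤2J
    kc≤ : k * c ≤ κ * n * c
    kc≤ = *-monoˡ c 0≤c k≤κn
    upper : B ≤ ι 3 * V + ι 5 * κ * J
    upper = begin
      B                                        ≤⟨ cancelˡ n 0<n (begin
        n * B                                      ≤⟨ B≤ ⟩
        ι 3 * (n * c) + k * c                      ≤⟨ ℚ.+-monoʳ-≤ (ι 3 * (n * c)) kc≤ ⟩
        ι 3 * (n * c) + κ * n * c
          ≡⟨ solve 4 (λ t n c k → t :* (n :* c) :+ k :* n :* c := n :* (t :* c :+ k :* c)) refl (ι 3) n c κ ⟩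
        n * (ι 3 * c + κ * c)                      ∎) ⟩
      -- Three of the five κ J come from replacing c by V, the other two from κ c ≤ 2 κ J.
      ι 3 * c + κ * c                          ≤⟨ ℚ.+-mono-≤ (*-monoʳ (ι 3) (0≤ι 3) c≤V) κc≤ ⟩
      ι 3 * (V + κ * J) + κ * (J + J)          ≡⟨ rearrange V ⟩
      ι 3 * V + ι 5 * κ * J                    ∎
      where
      rearrange : ∀ V → ι 3 * (V + κ * J) + κ * (J + J) ≡ ι 3 * V + ι 5 * κ * J
      rearrange V rewrite ι-3 | ι-5 = solve 3 (λ v k j → let one = con 1ℚ ; three = one :+ one :+ one in
        three :* (v :+ k :* j) :+ k :* (j :+ j) := three :* v :+ (three :+ one :+ one) :* k :* j) refl V κ J
    lower : ι 3 * V ≤ B + ι 5 * κ * J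
    lower = begin
      ι 3 * V                                  ≤⟨ *-monoʳ (ι 3) (0≤ι 3) V≤c ⟩
      ι 3 * (c + κ * J)                        ≡⟨ ℚ.*-distribˡ-+ (ι 3) c (κ * J) ⟩
      ι 3 * c + ι 3 * (κ * J)                  ≤⟨ ℚ.+-monoˡ-≤ (ι 3 * (κ * J)) (cancelˡ n 0<n (begin
        n * (ι 3 * c)                              ≡⟨ solve 3 (λ n t c → n :* (t :* c) := t :* (n :* c)) refl n (ι 3) c ⟩
        ι 3 * (n * c)                              ≤⟨ B≥ ⟩
        n * B + k * c                              ≤⟨ ℚ.+-monoʳ-≤ (n * B) kc≤ ⟩
        n * B + κ * n * c
          ≡⟨ solve 4 (λ n b k c → n :* b :+ k :* n :* c := n :* (b :+ k :* c)) refl n B κ c ⟩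
        n * (B + κ * c)                            ∎)) ⟩
      B + κ * c + ι 3 * (κ * J)                ≤⟨ ℚ.+-monoˡ-≤ (ι 3 * (κ * J)) (ℚ.+-monoʳ-≤ B κc≤) ⟩
      B + κ * (J + J) + ι 3 * (κ * J)          ≡⟨ rearrange ⟩
      B + ι 5 * κ * J                          ∎
      where
      rearrange : B + κ * (J + J) + ι 3 * (κ * J) ≡ B + ι 5 * κ * J
      rearrange rewrite ι-3 | ι-5 = solve 3 (λ b k j → let one = con 1ℚ ; three = one :+ one :+ one in
        b :+ k :* (j :+ j) :+ three :* (k :* j) := b :+ (three :+ one :+ one) :* k :* j) refl B κ J

  central²π : ℕ → ℕ → ℚ
  central²π n m = ι (central n) * ι (central n) * (π-seq m * ι n)

  16^ : ℕ → ℚ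
  16^ n = ι (4 ^ n) * ι (4 ^ n)

  private
    π-scaled : ∀ n m → let M = suc m in
      ι (n ℕ.* n ℕ.* (central n ℕ.* central n) ℕ.* (4 ℕ.* squaresInQuarterDisc M))
        ≡ ι n * central²π n m * ι (M ℕ.* M)
    π-scaled n m
      rewrite ι-* (n ℕ.* n ℕ.* (central n ℕ.* central n)) (4 ℕ.* squaresInQuarterDisc (suc m))
            | ι-* (n ℕ.* n) (central n ℕ.* central n) | ι-* n n | ι-* (central n) (central n)
            | sym (frac-cancel (4 ℕ.* squaresInQuarterDisc (suc m)) (suc m ℕ.* suc m)) =
      solve 4 (λ n c p M → n :* n :* (c :* c) :* (p :* M) := n :* (c :* c :* (p :* n)) :* M)
        refl (ι n) (ι (central n)) (π-seq m) (ι (suc m ℕ.* suc m))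

    16^-scaled : ∀ k n M → ι (k ℕ.* (4 ^ n ℕ.* 4 ^ n) ℕ.* M) ≡ ι k * 16^ n * ι M
    16^-scaled k n M = trans (ι-* (k ℕ.* (4 ^ n ℕ.* 4 ^ n)) M) (cong (_* ι M)
      (trans (ι-* k (4 ^ n ℕ.* 4 ^ n)) (cong (ι k *_) (ι-* (4 ^ n) (4 ^ n)))))

    0≤16^ : ∀ n → 0ℚ ≤ 16^ n
    0≤16^ n = *-nonNeg (0≤ι (4 ^ n)) (0≤ι (4 ^ n))

  central²π-≤ : ∀ l m η .{{_ : NonZero l}} → let n = suc l in
    ι 11 ≤ η * ι n → central²π n m ≤ 16^ n + η * 16^ n
  central²π-≤ l m η 11≤ηn = cancelˡ (ι n) (0<ι n) (cancelʳ (ι (M ℕ.* M)) (0<ι (M ℕ.* M)) (begin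
    ι n * central²π n m * ι (M ℕ.* M)            ≡⟨ π-scaled n m ⟨
    ι (n ℕ.* n ℕ.* (central n ℕ.* central n) ℕ.* (4 ℕ.* squaresInQuarterDisc M))
                                                 ≤⟨ ι-mono (central-disc-≤ l M) ⟩
    ι ((n ℕ.+ 11) ℕ.* (4 ^ n ℕ.* 4 ^ n) ℕ.* (M ℕ.* M))
                                                 ≡⟨ 16^-scaled (n ℕ.+ 11) n (M ℕ.* M) ⟩
    ι (n ℕ.+ 11) * 16^ n * ι (M ℕ.* M)             ≡⟨ cong (λ z → z * 16^ n * ι (M ℕ.* M)) (ι-+ n 11) ⟩
    (ι n + ι 11) * 16^ n * ι (M ℕ.* M)
      ≤⟨ *-monoˡ (ι (M ℕ.* M)) (0≤ι (M ℕ.* M)) (*-monoˡ (16^ n) (0≤16^ n) (ℚ.+-monoʳ-≤ (ι n) 11≤ηn)) ⟩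
    (ι n + η * ι n) * 16^ n * ι (M ℕ.* M)
      ≡⟨ solve 4 (λ n e w M → (n :+ e :* n) :* w :* M := n :* (w :+ e :* w) :* M)
           refl (ι n) η (16^ n) (ι (M ℕ.* M)) ⟩
    ι n * (16^ n + η * 16^ n) * ι (M ℕ.* M)          ∎))
    where
    open ℚ.≤-Reasoning
    n = suc l
    M = suc m

  central²π-≥ : ∀ n m η .{{_ : NonZero n}} → 8 ℕ.* (n ℕ.* n) ℕ.≤ suc m →
    ι 2 ≤ η * ι n → 16^ n ≤ central²π n m + η * 16^ n
  central²π-≥ n m η 8n²≤M 2≤ηn = cancelˡ (ι n) (0<ι n) (cancelʳ (ι (M ℕ.* M)) (0<ι (M ℕ.* M)) (begin
    ι n * 16^ n * ι (M ℕ.* M)                      ≡⟨ 16^-scaled n n (M ℕ.* M) ⟨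
    ι (n ℕ.* (4 ^ n ℕ.* 4 ^ n) ℕ.* (M ℕ.* M))    ≤⟨ ι-mono (central-disc-≥ n M 8n²≤M) ⟩
    ι (x ℕ.+ 2 ℕ.* (4 ^ n ℕ.* 4 ^ n) ℕ.* (M ℕ.* M))
      ≡⟨ ι-+ x (2 ℕ.* (4 ^ n ℕ.* 4 ^ n) ℕ.* (M ℕ.* M)) ⟩
    ι x + ι (2 ℕ.* (4 ^ n ℕ.* 4 ^ n) ℕ.* (M ℕ.* M))
      ≡⟨ cong₂ _+_ (π-scaled n m) (16^-scaled 2 n (M ℕ.* M)) ⟩
    ι n * central²π n m * ι (M ℕ.* M) + ι 2 * 16^ n * ι (M ℕ.* M)
      ≤⟨ ℚ.+-monoʳ-≤ (ι n * central²π n m * ι (M ℕ.* M))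
           (*-monoˡ (ι (M ℕ.* M)) (0≤ι (M ℕ.* M)) (*-monoˡ (16^ n) (0≤16^ n) 2≤ηn)) ⟩
    ι n * central²π n m * ι (M ℕ.* M) + η * ι n * 16^ n * ι (M ℕ.* M)
      ≡⟨ solve 5 (λ n y e w M → n :* y :* M :+ e :* n :* w :* M := n :* (y :+ e :* w) :* M)
           refl (ι n) (central²π n m) η (16^ n) (ι (M ℕ.* M)) ⟩
    ι n * (central²π n m + η * 16^ n) * ι (M ℕ.* M)  ∎))
    where
    open ℚ.≤-Reasoning
    M = suc m
    x = n ℕ.* n ℕ.* (central n ℕ.* central n) ℕ.* (4 ℕ.* squaresInQuarterDisc M)

  binomiacci-≤-ι : ∀ n .{{_ : NonZero n}} →
    ι n * ι (binomiacci n n) ≤ ι 3 * (ι n * ι (central n)) + ι 226 * ι (central n)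
  binomiacci-≤-ι n = subst₂ _≤_ (ι-* n (binomiacci n n)) (trans (ι-+ (3 ℕ.* (n ℕ.* central n)) (226 ℕ.* central n))
      (cong₂ _+_ (trans (ι-* 3 (n ℕ.* central n)) (cong (ι 3 *_) (ι-* n (central n)))) (ι-* 226 (central n))))
    (ι-mono (binomiacci-≤-central n))

  binomiacci-≥-ι : ∀ n .{{_ : NonZero n}} →
    ι 3 * (ι n * ι (central n)) ≤ ι n * ι (binomiacci n n) + ι 226 * ι (central n)
  binomiacci-≥-ι n = subst₂ _≤_ (trans (ι-* 3 (n ℕ.* central n)) (cong (ι 3 *_) (ι-* n (central n))))
    (trans (ι-+ (n ℕ.* binomiacci n n) (226 ℕ.* central n)) (cong₂ _+_ (ι-* n (binomiacci n n)) (ι-* 226 (central n))))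
    (ι-mono (binomiacci-≥-central n))

  opaque
    unfolding frac

    ½+½≡1 : frac 1 2 + frac 1 2 ≡ 1ℚ
    ½+½≡1 = refl

open RationalEstimates
open RationalLemmas
open import Defs

-- Reciprocals of real square roots, and the limit.

recip-inverse : ∀ y (0<y : 0ℝ < y) → Eventually λ m → seq y m ℚ.* seq (recip y {{0<y}}) m ≡ 1ℚ
recip-inverse y (mk< δ 0<δ (N , δ≤y)) = N , λ m N≤m →
  trans (cong (ℚ._* 1/cut m) (sym (ℚ.p≥q⇒p⊔q≡p (subst (ℚ._≤ seq y m) (ℚ.+-identityˡ δ) (δ≤y m N≤m)))))
        (cut*1/cut m)
  where open Reciprocal y (mk< δ 0<δ (N , δ≤y))

0<seq-recip : ∀ y (0<y : 0ℝ < y) m → 0ℚ ℚ.< seq (recip y {{0<y}}) m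
0<seq-recip y 0<y = Reciprocal.0<1/cut y 0<y

-- A bound uniform in m, so that the rounding error 1 / (m + 1) of a root stays small after
-- multiplication by the reciprocal.
recip-bounded : ∀ y (0<y : 0ℝ < y) m → seq (recip y {{0<y}}) m ℚ.* _<_.gap 0<y ℚ.≤ 1ℚ
recip-bounded y 0<y m = begin
  1/cut m ℚ.* δ          ≤⟨ *-monoʳ (1/cut m) (ℚ.<⇒≤ (0<1/cut m)) (ℚ.p≤q⊔p (seq y m) δ) ⟩
  1/cut m ℚ.* cut m      ≡⟨ ℚ.*-comm (1/cut m) (cut m) ⟩
  cut m ℚ.* 1/cut m      ≡⟨ cut*1/cut m ⟩
  1ℚ                     ∎
  where
  open Reciprocal y 0<y
  open ℚ.≤-Reasoning
  δ = _<_.gap 0<y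

-- Let r be the rounded-down root, h = 1 / (m + 1) and r v = 1. Multiplying r² ≤ x < (r + h)² by v²
-- gives 1 ≤ v² x ≤ (1 + v h)². Once v h ≤ θ = η / 3 ≤ 1, the last square is at most 1 + 3 θ.
recip-√ : ∀ x (0<√x : 0ℝ < √ x) → (∀ m → 0ℚ ℚ.≤ seq x m) → ∀ η → 0ℚ ℚ.< η → η ℚ.≤ 1ℚ →
  Eventually λ m → let v = seq (recip (√ x) {{0<√x}}) m in
    1ℚ ℚ.≤ v ℚ.* v ℚ.* seq x m × v ℚ.* v ℚ.* seq x m ℚ.≤ 1ℚ ℚ.+ η
recip-√ x 0<√x 0≤x η 0<η η≤1 =
  let δ           = _<_.gap 0<√x
      θ , 0<θ , 3θ≡η = shrink (ι 3) η (0<ι 3) 0<η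
      A , small   = archimedean 1 (δ ℚ.* θ) (*-pos (_<_.0<gap 0<√x) 0<θ)
      N , inverse = recip-inverse (√ x) 0<√x
  in N ℕ.⊔ A , λ m m≥ →
  let v = seq (recip (√ x) {{0<√x}}) m
      r = √-seq x m
      q = seq x m
      h = frac 1 (suc m)
      0≤v : 0ℚ ℚ.≤ v
      0≤v = ℚ.<⇒≤ (0<seq-recip (√ x) 0<√x m)
      0≤v² : 0ℚ ℚ.≤ v ℚ.* v
      0≤v² = *-nonNeg 0≤v 0≤v
      rv≡1 : r ℚ.* v ≡ 1ℚ
      rv≡1 = inverse m (ℕ.m⊔n≤o⇒m≤o N A m≥)
      q⊔0≡q : q ℚ.⊔ 0ℚ ≡ q
      q⊔0≡q = ℚ.p≥q⇒p⊔q≡p (0≤x m)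
      0≤q⊔0 = ℚ.p≤q⊔p q 0ℚ
      vh≤θ : v ℚ.* h ℚ.≤ θ
      vh≤θ = begin
        v ℚ.* h                  ≤⟨ *-monoʳ v 0≤v (small (suc m) (ℕ.m≤n⇒m≤1+n (ℕ.m⊔n≤o⇒n≤o N A m≥))) ⟩
        v ℚ.* (δ ℚ.* θ)          ≡⟨ ℚ.*-assoc v δ θ ⟨
        v ℚ.* δ ℚ.* θ            ≤⟨ *-monoˡ θ (ℚ.<⇒≤ 0<θ) (recip-bounded (√ x) 0<√x m) ⟩
        1ℚ ℚ.* θ                 ≡⟨ ℚ.*-identityˡ θ ⟩
        θ                        ∎
      0≤vh : 0ℚ ℚ.≤ v ℚ.* h
      0≤vh = *-nonNeg 0≤v (0≤frac 1 (suc m))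
      three : ∀ p → ι 3 ℚ.* p ≡ p ℚ.+ p ℚ.+ p
      three p = trans (cong (ℚ._* p) ι-3)
        (solve 1 (λ p → let one = con 1ℚ in (one :+ one :+ one) :* p := p :+ p :+ p) refl p)
      θ≤1 : θ ℚ.≤ 1ℚ
      θ≤1 = ℚ.≤-trans (p≤p+q θ (ℚ.<⇒≤ 0<θ)) (ℚ.≤-trans (p≤p+q (θ ℚ.+ θ) (ℚ.<⇒≤ 0<θ))
        (subst (ℚ._≤ 1ℚ) (trans (sym 3θ≡η) (three θ)) η≤1))
  in (begin
    1ℚ                                   ≡⟨ cong₂ ℚ._*_ rv≡1 rv≡1 ⟨
    r ℚ.* v ℚ.* (r ℚ.* v)                ≡⟨ solve 2 (λ r v → r :* v :* (r :* v) := v :* v :* (r :* r)) refl r v ⟩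
    v ℚ.* v ℚ.* (r ℚ.* r)                ≤⟨ *-monoʳ (v ℚ.* v) 0≤v² (rootApprox² (q ℚ.⊔ 0ℚ) (suc m) 0≤q⊔0) ⟩
    v ℚ.* v ℚ.* (q ℚ.⊔ 0ℚ)               ≡⟨ cong (v ℚ.* v ℚ.*_) q⊔0≡q ⟩
    v ℚ.* v ℚ.* q                        ∎) ,
  (begin
    v ℚ.* v ℚ.* q                        ≡⟨ cong (v ℚ.* v ℚ.*_) q⊔0≡q ⟨
    v ℚ.* v ℚ.* (q ℚ.⊔ 0ℚ)
      ≤⟨ *-monoʳ (v ℚ.* v) 0≤v² (ℚ.<⇒≤ (q<rootApprox² (q ℚ.⊔ 0ℚ) (suc m) 0≤q⊔0)) ⟩
    v ℚ.* v ℚ.* ((r ℚ.+ h) ℚ.* (r ℚ.+ h))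
      ≡⟨ solve 3 (λ v r h → v :* v :* ((r :+ h) :* (r :+ h)) := (r :* v :+ v :* h) :* (r :* v :+ v :* h)) refl v r h ⟩
    (r ℚ.* v ℚ.+ v ℚ.* h) ℚ.* (r ℚ.* v ℚ.+ v ℚ.* h)
      ≡⟨ cong (λ z → (z ℚ.+ v ℚ.* h) ℚ.* (z ℚ.+ v ℚ.* h)) rv≡1 ⟩
    (1ℚ ℚ.+ v ℚ.* h) ℚ.* (1ℚ ℚ.+ v ℚ.* h)
      ≡⟨ solve 1 (λ t → (con 1ℚ :+ t) :* (con 1ℚ :+ t) := con 1ℚ :+ (t :+ t :+ t :* t)) refl (v ℚ.* h) ⟩
    1ℚ ℚ.+ (v ℚ.* h ℚ.+ v ℚ.* h ℚ.+ v ℚ.* h ℚ.* (v ℚ.* h))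
      ≤⟨ ℚ.+-monoʳ-≤ 1ℚ (ℚ.+-mono-≤ (ℚ.+-mono-≤ vh≤θ vh≤θ)
           (*-mono {v ℚ.* h} {1ℚ} {v ℚ.* h} {θ} 0≤vh (ℚ.<⇒≤ 0<θ) (ℚ.≤-trans vh≤θ θ≤1) vh≤θ)) ⟩
    1ℚ ℚ.+ (θ ℚ.+ θ ℚ.+ 1ℚ ℚ.* θ)        ≡⟨ cong (λ z → 1ℚ ℚ.+ (θ ℚ.+ θ ℚ.+ z)) (ℚ.*-identityˡ θ) ⟩
    1ℚ ℚ.+ (θ ℚ.+ θ ℚ.+ θ)               ≡⟨ cong (1ℚ ℚ.+_) (trans (sym (three θ)) 3θ≡η) ⟩
    1ℚ ℚ.+ η                             ∎)
  where
  open ℚSolver.+-*-Solver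
  open ℚ.≤-Reasoning

corollary3p2 : (λ n → fromℕ (binomiacci n n)) ≐
    (λ n → fromℕ 3 * fromℕ (4 ^ n) / √ (π * fromℕ n)) +o
    (λ n → fromℕ (4 ^ n) / √ (fromℕ n))
corollary3p2 ε (mk< e 0<e (E , e≤ε)) = N₀ , λ n N₀≤n → bound n N₀≤n
  where
  open ℚSolver.+-*-Solver
  open ℚ.≤-Reasoning
  -- κ = e / 5, where e is a rational that eventually stays below ε and 5 is the factor from
  -- `diagonal-estimate`.
  κ = proj₁ (shrink (ι 5) e (0<ι 5) 0<e)
  0<κ = proj₁ (proj₂ (shrink (ι 5) e (0<ι 5) 0<e))
  5κ≡e = proj₂ (proj₂ (shrink (ι 5) e (0<ι 5) 0<e))
  A = proj₁ (archimedean 226 κ 0<κ)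
  -- For η = 11/n, `A` ensures 226/n ≤ κ and so 3 η ≤ κ, while 22 ensures 2 η ≤ 1.
  N₀ = A ℕ.⊔ 22
  bound : ∀ n .{{_ : NonZero n}} → N₀ ℕ.≤ n →
    ∣ fromℕ (binomiacci n n) - fromℕ 3 * fromℕ (4 ^ n) / √ (π * fromℕ n) ∣
      ≤ ε * ∣ fromℕ (4 ^ n) / √ (fromℕ n) ∣
  -- From here n is fixed: an inequality of reals concerns all large m, and the threshold for m may
  -- depend on n.
  bound n N₀≤n ε′ 0<ε′ = (K ℕ.⊔ L) ℕ.⊔ (L′ ℕ.⊔ E) , λ m m≥ →
    let K≤m , L≤m , L′≤m , E≤m = split m m≥
        v = seq (recip (√ (π * fromℕ n)) {{√-pos}}) m
        j = seq (recip (√ (fromℕ n)) {{√-pos}}) m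
        x = π-seq m ℚ.* ι n
        V = W ℚ.* v
        J = W ℚ.* j
        B = ι (binomiacci n n)
        1≤v²x , v²x≤1+η = v² m L≤m
        0≤v = ℚ.<⇒≤ (0<seq-recip (√ (π * fromℕ n)) √-pos m)
        0≤j = ℚ.<⇒≤ (0<seq-recip (√ (fromℕ n)) √-pos m)
        0≤J = *-nonNeg (0≤ι (4 ^ n)) 0≤j
        h≤π = subst (ℚ._≤ π-seq m) (ℚ.+-identityˡ (frac 1 2)) (proj₂ (_<_.below π-pos) m (ℕ.m⊔n≤o⇒m≤o 16 (8 ℕ.* (n ℕ.* n)) K≤m))
        upper , lower = diagonal-estimate {ι n} {x} {16^ n} {ι (central n)} {V} {J} {B} {κ} {η} {ι 226}
          (0<ι n) (*-pos (ℚ.<-≤-trans (0<frac 1 2) h≤π) (0<ι n)) 0<16^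
          (0≤ι (central n)) (*-nonNeg (0≤ι (4 ^ n)) 0≤v) 0≤J 0<η 3η≤κ 2η≤1 226≤κn
          (begin
            ι n                                    ≡⟨ ℚ.*-identityˡ (ι n) ⟨
            1ℚ ℚ.* ι n                             ≡⟨ cong (ℚ._* ι n) ½+½≡1 ⟨
            (frac 1 2 ℚ.+ frac 1 2) ℚ.* ι n        ≤⟨ *-monoˡ (ι n) (0≤ι n) (ℚ.+-mono-≤ h≤π h≤π) ⟩
            (π-seq m ℚ.+ π-seq m) ℚ.* ι n          ≡⟨ ℚ.*-distribʳ-+ (ι n) (π-seq m) (π-seq m) ⟩
            x ℚ.+ x                                ∎)
          (scale (proj₁ (j² m L′≤m)))
          (central²π-≤′ n (ℕ.m⊔n≤o⇒n≤o A 22 N₀≤n) m)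
          (central²π-≥ n m η (ℕ.m≤n⇒m≤1+n (ℕ.m⊔n≤o⇒n≤o 16 (8 ℕ.* (n ℕ.* n)) K≤m))
            (ℚ.≤-trans (ι-mono (ℕ.m≤m+n 2 9)) 11≤ηn))
          (scale 1≤v²x)
          (begin
            V ℚ.* V ℚ.* x
              ≡⟨ solve 3 (λ W v x → W :* v :* (W :* v) :* x := W :* W :* (v :* v :* x)) refl W v x ⟩
            16^ n ℚ.* (v ℚ.* v ℚ.* x)                ≤⟨ *-monoʳ (16^ n) (ℚ.<⇒≤ 0<16^) v²x≤1+η ⟩
            16^ n ℚ.* (1ℚ ℚ.+ η)
              ≡⟨ solve 2 (λ w e → w :* (con 1ℚ :+ e) := w :+ e :* w) refl (16^ n) η ⟩
            16^ n ℚ.+ η ℚ.* 16^ n                      ∎)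
          (binomiacci-≤-ι n) (binomiacci-≥-ι n)
        eJ≤ : ι 5 ℚ.* κ ℚ.* J ℚ.≤ seq ε m ℚ.* ℚ.∣ J ∣ ℚ.+ ε′
        eJ≤ = begin
          ι 5 ℚ.* κ ℚ.* J                          ≡⟨ cong (ℚ._* J) 5κ≡e ⟩
          e ℚ.* J                                  ≤⟨ *-monoˡ J 0≤J (subst (ℚ._≤ seq ε m) (ℚ.+-identityˡ e) (e≤ε m E≤m)) ⟩
          seq ε m ℚ.* J                            ≡⟨ cong (seq ε m ℚ.*_) (ℚ.0≤p⇒∣p∣≡p 0≤J) ⟨
          seq ε m ℚ.* ℚ.∣ J ∣                      ≤⟨ p≤p+q _ (ℚ.<⇒≤ 0<ε′) ⟩
          seq ε m ℚ.* ℚ.∣ J ∣ ℚ.+ ε′               ∎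
    in subst (λ z → ℚ.∣ B ℚ.- z ∣ ℚ.≤ seq ε m ℚ.* ℚ.∣ J ∣ ℚ.+ ε′) (sym (ℚ.*-assoc (ι 3) W v))
         (ℚ.≤-trans (≤⇒dist B (ι 3 ℚ.* V) upper lower) eJ≤)
    where
    W = ι (4 ^ n)
    instance
      4^n≢0 : NonZero (4 ^ n)
      4^n≢0 = ℕ.m^n≢0 4 n
    0<16^ : 0ℚ ℚ.< 16^ n
    0<16^ = *-pos (0<ι (4 ^ n)) (0<ι (4 ^ n))
    scale : ∀ {v x} → 1ℚ ℚ.≤ v ℚ.* v ℚ.* x → 16^ n ℚ.≤ W ℚ.* v ℚ.* (W ℚ.* v) ℚ.* x
    scale {v} {x} 1≤ = begin
      16^ n                               ≡⟨ ℚ.*-identityʳ (16^ n) ⟨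
      16^ n ℚ.* 1ℚ                        ≤⟨ *-monoʳ (16^ n) (ℚ.<⇒≤ 0<16^) 1≤ ⟩
      16^ n ℚ.* (v ℚ.* v ℚ.* x)
        ≡⟨ solve 3 (λ W v x → W :* W :* (v :* v :* x) := W :* v :* (W :* v) :* x) refl W v x ⟩
      W ℚ.* v ℚ.* (W ℚ.* v) ℚ.* x       ∎
    -- The relative error of `central²π-≤`, which also covers the 2/n of `central²π-≥`.
    η = frac 11 n
    0<η : 0ℚ ℚ.< η
    0<η = 0<frac 11 n
    11≤ηn : ι 11 ℚ.≤ η ℚ.* ι n
    11≤ηn = ℚ.≤-reflexive (sym (frac-cancel 11 n))
    226≤κn : ι 226 ℚ.≤ κ ℚ.* ι n
    226≤κn = subst (ℚ._≤ κ ℚ.* ι n) (frac-cancel 226 n)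
      (*-monoˡ (ι n) (0≤ι n) (proj₂ (archimedean 226 κ 0<κ) n (ℕ.m⊔n≤o⇒m≤o A 22 N₀≤n)))
    2η*n : (η ℚ.+ η) ℚ.* ι n ≡ ι 22
    2η*n = trans (ℚ.*-distribʳ-+ (ι n) η η) (trans (cong₂ ℚ._+_ (frac-cancel 11 n) (frac-cancel 11 n)) (sym (ι-+ 11 11)))
    3η≤κ : η ℚ.+ η ℚ.+ η ℚ.≤ κ
    3η≤κ = cancelʳ (ι n) (0<ι n) (begin
      (η ℚ.+ η ℚ.+ η) ℚ.* ι n                ≡⟨ ℚ.*-distribʳ-+ (ι n) (η ℚ.+ η) η ⟩
      (η ℚ.+ η) ℚ.* ι n ℚ.+ η ℚ.* ι n        ≡⟨ cong₂ ℚ._+_ 2η*n (frac-cancel 11 n) ⟩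
      ι 22 ℚ.+ ι 11                          ≡⟨ ι-+ 22 11 ⟨
      ι 33                                   ≤⟨ ι-mono (ℕ.m≤m+n 33 193) ⟩
      ι 226                                  ≤⟨ 226≤κn ⟩
      κ ℚ.* ι n                              ∎)
    2η≤1 : η ℚ.+ η ℚ.≤ 1ℚ
    2η≤1 = cancelʳ (ι n) (0<ι n) (begin
      (η ℚ.+ η) ℚ.* ι n                      ≡⟨ 2η*n ⟩
      ι 22                                   ≤⟨ ι-mono (ℕ.m⊔n≤o⇒n≤o A 22 N₀≤n) ⟩
      ι n                                    ≡⟨ ℚ.*-identityˡ (ι n) ⟨
      1ℚ ℚ.* ι n                             ∎)
    η≤1 : η ℚ.≤ 1ℚ
    η≤1 = ℚ.≤-trans (p≤p+q η (ℚ.<⇒≤ 0<η)) 2η≤1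
    central²π-≤′ : ∀ n .{{_ : NonZero n}} → 22 ℕ.≤ n → ∀ m → central²π n m ℚ.≤ 16^ n ℚ.+ frac 11 n ℚ.* 16^ n
    central²π-≤′ n@(suc (suc l)) _ m =
      central²π-≤ (suc l) m (frac 11 n) (ℚ.≤-reflexive (sym (frac-cancel 11 n)))
    central²π-≤′ 1 (s≤s ()) m
    0≤πn : ∀ m → 0ℚ ℚ.≤ π-seq m ℚ.* ι n
    0≤πn m = *-nonNeg (0≤frac (4 ℕ.* squaresInQuarterDisc (suc m)) (suc m ℕ.* suc m)) (0≤ι n)
    v-estimate = recip-√ (π * fromℕ n) √-pos 0≤πn η 0<η η≤1
    j-estimate = recip-√ (fromℕ n) √-pos (λ _ → 0≤ι n) 1ℚ (ℚ.positive⁻¹ 1ℚ) ℚ.≤-refl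
    -- 16 is the threshold in `π-pos` from which `π-seq m` is at least 1/2; 8 n² is what
    -- `central²π-≥` demands.
    K = 16 ℕ.⊔ 8 ℕ.* (n ℕ.* n)
    L = proj₁ v-estimate
    v² = proj₂ v-estimate
    L′ = proj₁ j-estimate
    j² = proj₂ j-estimate
    split : ∀ m → (K ℕ.⊔ L) ℕ.⊔ (L′ ℕ.⊔ E) ℕ.≤ m → K ℕ.≤ m × L ℕ.≤ m × L′ ℕ.≤ m × E ℕ.≤ m
    split m m≥ = ℕ.m⊔n≤o⇒m≤o K L KL , ℕ.m⊔n≤o⇒n≤o K L KL , ℕ.m⊔n≤o⇒m≤o L′ E LE , ℕ.m⊔n≤o⇒n≤o L′ E LE
      where
      KL = ℕ.m⊔n≤o⇒m≤o (K ℕ.⊔ L) (L′ ℕ.⊔ E) m≥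
      LE = ℕ.m⊔n≤o⇒n≤o (K ℕ.⊔ L) (L′ ℕ.⊔ E) m≥
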